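{- Consider the online graph partitioning problem with $\ell$ servers, server capacity $k$, and a fixed constant $\varepsilon$ with $(10/k)^{1/4}\le \varepsilon<1/4$, where the online algorithm may place up to $(1+\varepsilon)k$ vertices on each server. There exists a deterministic online algorithm whose competitive ratio is $O(\ell\log k)$ (the constant hidden in the $O$-notation may depend on $\varepsilon$).
   Context: Online graph partitioning problem: There is a vertex set $V$ with $|V|=\ell\cdot k$. Initially each vertex is assigned to one of $\ell$ servers so that every server holds exactly $k$ vertices, and the graph $G=(V,E)$ has $E=\emptyset$. Edges of $G$ are then revealed one by one in an online fashion. The request sequence is guaranteed to be such that at all times there exists an assignment of vertices to servers in which each server holds at most $k$ vertices and every connected component of the current graph lies entirely on one server. After each edge insertion, an online algorithm must (possibly) move vertices between servers so that every connected component of the revealed graph lies entirely on a single server (cc-condition), while each server holds at most $(1+\varepsilon)k$ vertices. Each vertex move costs $1/k$. The optimal offline algorithm $\mathrm{OPT}$ knows the whole sequence in advance and must keep at most $k$ vertices per server; its cost is the minimum total cost of moves needed to satisfy the cc-condition throughout. The (strict) competitive ratio of an online algorithm $\mathrm{ONL}$ is the supremum over request sequences of $\mathrm{cost}(\mathrm{ONL})/\mathrm{cost}(\mathrm{OPT})$; for deterministic algorithms the edge insertion order is adversarial.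
   Formalization: The constant ε is taken to be a rational number rather than an arbitrary real; the condition (10/k)^{1/4} ≤ ε is written as 10/k ≤ ε⁴ with ε > 0. -}

module Defs where

open import Data.Nat as ℕ using (ℕ; zero; suc; _+_; _*_; _≤_)
open import Data.Fin using (Fin)
open import Data.Fin.Properties using (_≟_)
open import Data.List using (List; []; _∷_; length; filter; take; allFin)
open import Data.List.Membership.Propositional using (_∈_)
open import Data.Product using (_×_; _,_; ∃)
open import Data.Integer using (+_)
open import Data.Rational as ℚ using (ℚ; _/_)
open import Relation.Nullary using (¬?)
open import Relation.Binary.PropositionalEquality using (_≡_)

Edge : ℕ → Set
Edge n = Fin n × Fin n

Config : ℕ → ℕ → Set
Config ℓ n = Fin n → Fin ℓ

data Conn {n : ℕ} (es : List (Edge n)) : Fin n → Fin n → Set where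
  here : ∀ {u} → Conn es u u
  fwd  : ∀ {u v w} → (u , v) ∈ es → Conn es v w → Conn es u w
  bwd  : ∀ {u v w} → (v , u) ∈ es → Conn es v w → Conn es u w

CC : ∀ {ℓ n} → List (Edge n) → Config ℓ n → Set
CC es σ = ∀ u v → Conn es u v → σ u ≡ σ v

load : ∀ {ℓ n} → Config ℓ n → Fin ℓ → ℕ
load {n = n} σ s = length (filter (λ v → σ v ≟ s) (allFin n))

-- number of vertices whose server differs between two configurations
-- (= minimum number of vertex moves to go from σ to τ)
moves : ∀ {ℓ n} → Config ℓ n → Config ℓ n → ℕ
moves {n = n} σ τ = length (filter (λ v → ¬? (σ v ≟ τ v)) (allFin n))

Balanced : ∀ {ℓ n} → ℕ → Config ℓ n → Set
Balanced k σ = ∀ s → load σ s ≡ k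

CapOK : ∀ {ℓ n} → ℕ → Config ℓ n → Set
CapOK k σ = ∀ s → load σ s ≤ k

AugCapOK : ∀ {ℓ n} → ℚ → ℕ → Config ℓ n → Set
AugCapOK ε k σ = ∀ s → (+ load σ s / 1) ℚ.≤ (ℚ.1ℚ ℚ.+ ε) ℚ.* (+ k / 1)

sumTo : ℕ → (ℕ → ℕ) → ℕ
sumTo zero    f = 0
sumTo (suc T) f = sumTo T f + f T

ValidSeq : ∀ (ℓ k : ℕ) → List (Edge (ℓ * k)) → Set
ValidSeq ℓ k es = ∀ t → t ≤ length es →
  ∃ λ (σ : Config ℓ (ℓ * k)) → CC (take t es) σ × CapOK k σ

-- A deterministic online algorithm: given the initial configuration and
-- the prefix of edges revealed so far, it outputs the current configuration.
OnlineAlg : ℕ → ℕ → Set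
OnlineAlg ℓ k = Config ℓ (ℓ * k) → List (Edge (ℓ * k)) → Config ℓ (ℓ * k)

onlConf : ∀ {ℓ k} → OnlineAlg ℓ k → Config ℓ (ℓ * k) → List (Edge (ℓ * k))
        → ℕ → Config ℓ (ℓ * k)
onlConf A init es zero    = init
onlConf A init es (suc t) = A init (take (suc t) es)

OnlFeasible : ∀ {ℓ k} → ℚ → OnlineAlg ℓ k → Config ℓ (ℓ * k)
            → List (Edge (ℓ * k)) → Set
OnlFeasible {ℓ} {k} ε A init es = ∀ t → t ≤ length es →
  CC (take t es) (onlConf A init es t) × AugCapOK ε k (onlConf A init es t)

-- total number of moves of the online algorithm (cost × k)
onlMoves : ∀ {ℓ k} → OnlineAlg ℓ k → Config ℓ (ℓ * k)
         → List (Edge (ℓ * k)) → ℕ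
onlMoves A init es =
  sumTo (length es) (λ t → moves (onlConf A init es t) (onlConf A init es (suc t)))

OffFeasible : ∀ {ℓ k} → Config ℓ (ℓ * k) → List (Edge (ℓ * k))
            → (ℕ → Config ℓ (ℓ * k)) → Set
OffFeasible {ℓ} {k} init es S = (∀ v → S 0 v ≡ init v) ×
  (∀ t → t ≤ length es → CC (take t es) (S t) × CapOK k (S t))

-- total number of moves of an offline schedule (cost × k)
offMoves : ∀ {ℓ k} → List (Edge (ℓ * k)) → (ℕ → Config ℓ (ℓ * k)) → ℕ
offMoves es S = sumTo (length es) (λ t → moves (S t) (S (suc t)))

{-# OPTIONS --safe #-}

-- Components are the fibres of a labelling of the vertices, and the offline cost is at least the number D of
-- vertices that any component-respecting assignment must remove from their initial servers.
--
-- While some assignment has D ≤ k / 2m, where m is twice the denominator of ε, every component stays on a server that holds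
-- a near-majority of its vertices; then the capacity is exceeded by at most 4 D vertices. A part of a merged component
-- is moved only when ⌊log₂ size⌋ grows, and its size is at most 4 times the number of its vertices misplaced at the
-- new server, so the total cost is O(D log k).
--
-- Afterwards the offline cost is at least k / 2m, and a total cost of O(ℓ k log k) suffices. Components of at least
-- k / m vertices get a weight, their size rounded down to a multiple of k / m², and each server carries total weight
-- at most m². A merge that does not change the weights moves the smaller part to the larger one. There are O(ℓ) other
-- merges, and each of them changes only O(1) servers: two packings differ by vectors of bounded dimension and entries
-- whose sum is zero, so the servers split into blocks of bounded size with zero sum, and it suffices to rearrange the
-- block that receives the merged component. Small components are evicted from overloaded servers to servers of load
-- at most k, which is paid by the moves that caused the overload.
module Submission where

open import Defs
open import Data.Empty using (⊥)
open import Data.Fin using (Fin; zero; suc; toℕ; fromℕ<)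
open import Data.Fin.Permutation using (transpose)
import Data.Fin.Permutation.Components as Transposition
open import Data.Fin.Properties using (_≟_; any?; all?; toℕ-fromℕ<)
import Data.Integer as ℤ
import Data.Integer.Properties as ℤ
open import Data.List using (List; []; _∷_; _∷ʳ_; length; filter; tabulate; foldl; take; lookup)
open import Data.List.Membership.Propositional using (_∈_)
open import Data.List.Membership.Propositional.Properties using (∈-++⁺ˡ; ∈-++⁺ʳ; ∈-++⁻)
open import Data.List.Properties using (take-suc; foldl-∷ʳ)
open import Data.List.Relation.Unary.Any using (here)
open import Data.Nat using (ℕ; zero; suc; _+_; _*_; _∸_; _^_; _≤_; _<_; z≤n; s≤s; NonZero; nonZero; >-nonZero; ≢-nonZero⁻¹; _≤?_; _<?_; ⌊_/2⌋; ⌈_/2⌉) renaming (_/_ to _div_)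
open import Data.Nat.DivMod using (m/n*n≤m; m≡m%n+[m/n]*n; m%n<n; m*n/n≡m; /-monoˡ-≤; 0/n≡0)
open import Data.Nat.Induction using (<-rec)
open import Data.Nat.Logarithm using (⌊log₂_⌋; ⌊log₂⌋-mono-≤; ⌊log₂⌊n/2⌋⌋≡⌊log₂n⌋∸1; ⌊log₂[2*b]⌋≡1+⌊log₂b⌋; ⌊log₂[2^n]⌋≡n)
open import Data.Nat.Properties renaming (_≟_ to _≟ℕ_)
open import Data.Nat.Tactic.RingSolver using (solve; solve-∀)
open import Data.Product using (∃; _×_; _,_; proj₁; proj₂)
import Data.Rational as ℚ
import Data.Rational.Properties as ℚ
import Data.Rational.Unnormalised as ℚᵘ
import Data.Rational.Unnormalised.Properties as ℚᵘ
open import Data.Sum using (_⊎_; inj₁; inj₂)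
open import Function using (_∘_)
open import Relation.Binary.PropositionalEquality
open import Relation.Nullary using (Dec; yes; no; ¬_; ¬?; contradiction)
open import Relation.Nullary.Decidable using (_×-dec_; decidable-stable)
open import Relation.Unary using (Pred; Decidable)
open import Algebra.Properties.Semiring.Sum +-*-semiring using (sum; sum-cong-≗; ∑-distrib-+; ∑-comm; *-distribˡ-sum; sum-permute)

-- Finite sums and fibres

≤-by-cancel : ∀ w l r {x y} → l ≤ r → x + w ≡ l → r ≡ y + w → x ≤ y
≤-by-cancel w l r {x} {y} l≤r refl refl = +-cancelʳ-≤ w x y l≤r

≤-by-rearrange : ∀ l r {x y} → l ≤ r → x ≡ l → r ≡ y → x ≤ y
≤-by-rearrange l r l≤r refl refl = l≤r

χ : ∀ {p} {P : Set p} → Dec P → ℕ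
χ (yes _) = 1
χ (no _)  = 0

module _ {p} {P : Set p} where

  χ-yes : (d : Dec P) → P → χ d ≡ 1
  χ-yes (yes _) _  = refl
  χ-yes (no ¬p) x = contradiction x ¬p

  χ-no : (d : Dec P) → ¬ P → χ d ≡ 0
  χ-no (yes x) ¬p = contradiction x ¬p
  χ-no (no _) _   = refl

  χ≤1 : (d : Dec P) → χ d ≤ 1
  χ≤1 (yes _) = ≤-refl
  χ≤1 (no _)  = z≤n

χ-mono : ∀ {p q} {P : Set p} {Q : Set q} (d : Dec P) (e : Dec Q) → (P → Q) → χ d ≤ χ e
χ-mono (yes x) e f rewrite χ-yes e (f x) = ≤-refl
χ-mono (no _)  e f = z≤n

χ-cong : ∀ {p q} {P : Set p} {Q : Set q} (d : Dec P) (e : Dec Q) → (P → Q) → (Q → P) → χ d ≡ χ e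
χ-cong d e f g = ≤-antisym (χ-mono d e f) (χ-mono e d g)

χ-*-≤ : ∀ {p} {P : Set p} (d : Dec P) {x y} → (P → x ≤ y) → χ d * x ≤ y
χ-*-≤ (yes p) {x} h = ≤-trans (≤-reflexive (*-identityˡ x)) (h p)
χ-*-≤ (no _)  h = z≤n

length-filter-tabulate : ∀ {a p} {A : Set a} {P : Pred A p} (P? : Decidable P) {n} (f : Fin n → A) →
  length (filter P? (tabulate f)) ≡ sum (λ i → χ (P? (f i)))
length-filter-tabulate P? {zero}  f = refl
length-filter-tabulate P? {suc n} f with P? (f zero)
... | yes _ = cong suc (length-filter-tabulate P? (f ∘ suc))
... | no _  = length-filter-tabulate P? (f ∘ suc)

sum-mono : ∀ {n} {f g : Fin n → ℕ} → (∀ i → f i ≤ g i) → sum f ≤ sum g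
sum-mono {zero}  h = z≤n
sum-mono {suc n} h = +-mono-≤ (h zero) (sum-mono (h ∘ suc))

sum-const : ∀ n x → sum {n} (λ _ → x) ≡ n * x
sum-const zero    x = refl
sum-const (suc n) x = cong (x +_) (sum-const n x)

sum-zero : ∀ {n} {f : Fin n → ℕ} → (∀ i → f i ≡ 0) → sum f ≡ 0
sum-zero {n} h = trans (sum-cong-≗ h) (trans (sum-const n 0) (*-zeroʳ n))

sum-χ-* : ∀ {n} (a : Fin n) (f : Fin n → ℕ) → sum (λ i → χ (a ≟ i) * f i) ≡ f a
sum-χ-* {suc n} zero f = trans
  (cong₂ _+_ (+-identityʳ (f zero)) (sum-zero {f = λ i → χ (zero ≟ suc i) * f (suc i)} (λ i → cong (_* f (suc i)) (χ-no (zero ≟ suc i) (λ ())))))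
  (+-identityʳ (f zero))
sum-χ-* {suc n} (suc a) f = trans
  (cong₂ _+_ (cong (_* f zero) (χ-no (suc a ≟ zero) (λ ())))
     (sum-cong-≗ {n = n} (λ i → cong (_* f (suc i)) (χ-cong (suc a ≟ suc i) (a ≟ i) (λ { refl → refl }) (cong suc)))))
  (sum-χ-* a (f ∘ suc))

term≤sum : ∀ {n} (f : Fin n → ℕ) a → f a ≤ sum f
term≤sum f a = ≤-trans (≤-reflexive (sym (sum-χ-* a f)))
  (sum-mono (λ i → χ-*-≤ (a ≟ i) (λ _ → ≤-refl)))

sum-strict : ∀ {n} {f g : Fin n → ℕ} → (∀ i → f i ≤ g i) → ∀ a → f a < g a → sum f < sum g
sum-strict {suc n} h zero    lt = +-mono-<-≤ lt (sum-mono (h ∘ suc))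
sum-strict {suc n} h (suc a) lt = +-mono-≤-< (h zero) (sum-strict (h ∘ suc) a lt)

-- A merge or a relocation changes a sum at two indices, where only a joint inequality is available;
-- the remaining indices are compared termwise.
sum-mono-pair : ∀ {n} {f g : Fin n → ℕ} {a b : Fin n} x → a ≢ b →
  (∀ c → c ≢ a → c ≢ b → f c ≤ g c) → f a + f b + x ≤ g a + g b → sum f + x ≤ sum g
sum-mono-pair {n} {f} {g} {a} {b} x a≢b other pair =
  ≤-by-cancel (f a + g a) _ _ summed
    (arith₁ (sum f) x (f a) (g a)) (arith₂ (sum g) (f a) (g a))
  where
  arith₁ : ∀ s x p q → s + x + (p + q) ≡ s + (p + x) + q
  arith₁ = solve-∀
  arith₂ : ∀ s p q → s + q + p ≡ s + (p + q)
  arith₂ = solve-∀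
  arith₃ : ∀ p q x → q + (p + x) ≡ p + q + x
  arith₃ = solve-∀
  -- Correction terms make the comparison termwise: at `a` both sides become `f a + g a`, and at `b`
  -- the joint inequality appears. Cancelling them at the end avoids subtraction.
  lhs rhs : Fin n → ℕ
  lhs c = f c + χ (b ≟ c) * (f a + x) + χ (a ≟ c) * g a
  rhs c = g c + χ (b ≟ c) * g a + χ (a ≟ c) * f a
  split : ∀ (h : Fin n → ℕ) u v → sum (λ c → h c + χ (b ≟ c) * u + χ (a ≟ c) * v) ≡ sum h + u + v
  split h u v = trans (∑-distrib-+ (λ c → h c + χ (b ≟ c) * u) (λ c → χ (a ≟ c) * v))
    (cong₂ _+_ (trans (∑-distrib-+ h (λ c → χ (b ≟ c) * u)) (cong (sum h +_) (sum-χ-* b (λ _ → u)))) (sum-χ-* a (λ _ → v)))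
  pointwise : ∀ c → lhs c ≤ rhs c
  pointwise c with b ≟ c | a ≟ c
  ... | yes refl | yes refl = contradiction refl a≢b
  ... | yes refl | no _ rewrite +-identityʳ (f b + (f a + x + 0)) | +-identityʳ (f a + x)
                              | +-identityʳ (g b + (g a + 0)) | +-identityʳ (g a) =
    ≤-trans (≤-reflexive (arith₃ (f a) (f b) x)) (≤-trans pair (≤-reflexive (+-comm (g a) (g b))))
  ... | no _ | yes refl rewrite +-identityʳ (f a) | +-identityʳ (g a) = ≤-reflexive (+-comm (f a) (g a))
  ... | no b≢c | no a≢c = +-monoˡ-≤ 0 (+-monoˡ-≤ 0 (other c (λ { refl → a≢c refl }) (λ { refl → b≢c refl })))
  summed : sum f + (f a + x) + g a ≤ sum g + g a + f a
  summed = subst₂ _≤_ (split f (f a + x) (g a)) (split g (g a) (f a)) (sum-mono pointwise)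

-- The pushforward of `g` along `rep`. It serves for vertices in components, vertices on servers and
-- weights of components on servers.
cl : ∀ {n N} → (Fin n → Fin N) → (Fin n → ℕ) → Fin N → ℕ
cl rep g c = sum (λ v → χ (rep v ≟ c) * g v)

-- g may depend on the class: double counting of pairs (class, member).
sum-cl : ∀ {n N} (rep : Fin n → Fin N) (g : Fin N → Fin n → ℕ) →
  sum (λ c → cl rep (g c) c) ≡ sum (λ v → g (rep v) v)
sum-cl {n} {N} rep g = trans (∑-comm (λ c v → χ (rep v ≟ c) * g c v))
  (sum-cong-≗ (λ v → sum-χ-* (rep v) (λ c → g c v)))

cl-*ˡ : ∀ {n N} (rep : Fin n → Fin N) x (g : Fin n → ℕ) c → cl rep (λ v → x * g v) c ≡ x * cl rep g c
cl-*ˡ rep x g c = trans (sum-cong-≗ (λ v → arith (χ (rep v ≟ c)) x (g v)))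
  (sym (*-distribˡ-sum x (λ v → χ (rep v ≟ c) * g v)))
  where
  arith : ∀ p x y → p * (x * y) ≡ x * (p * y)
  arith = solve-∀

cl-mono : ∀ {n N} (rep : Fin n → Fin N) {g h : Fin n → ℕ} → (∀ v → g v ≤ h v) → ∀ c → cl rep g c ≤ cl rep h c
cl-mono rep g≤h c = sum-mono (λ v → *-monoʳ-≤ (χ (rep v ≟ c)) (g≤h v))

cl-+ : ∀ {n N} (rep : Fin n → Fin N) (g h : Fin n → ℕ) c → cl rep (λ v → g v + h v) c ≡ cl rep g c + cl rep h c
cl-+ rep g h c = trans (sum-cong-≗ (λ v → *-distribˡ-+ (χ (rep v ≟ c)) (g v) (h v)))
  (∑-distrib-+ (λ v → χ (rep v ≟ c) * g v) (λ v → χ (rep v ≟ c) * h v))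

term≤cl : ∀ {n N} (rep : Fin n → Fin N) (g : Fin n → ℕ) v → g v ≤ cl rep g (rep v)
term≤cl rep g v = ≤-trans (≤-reflexive (sym (trans (cong (_* g v) (χ-yes (rep v ≟ rep v) refl)) (*-identityˡ (g v)))))
  (term≤sum (λ w → χ (rep w ≟ rep v) * g w) v)

-- Merging of classes. The label `a` survives with an empty class, so the type of labels never
-- changes.
relabel : ∀ {N} → Fin N → Fin N → Fin N → Fin N
relabel a b c with c ≟ a
... | yes _ = b
... | no _  = c

relabel-hit : ∀ {N} (a b : Fin N) → relabel a b a ≡ b
relabel-hit a b with a ≟ a
... | yes _   = refl
... | no a≢a = contradiction refl a≢a

relabel-miss : ∀ {N} {a b c : Fin N} → c ≢ a → relabel a b c ≡ c
relabel-miss {a = a} {c = c} c≢a with c ≟ a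
... | yes c≡a = contradiction c≡a c≢a
... | no _     = refl

module _ {n N} (rep : Fin n → Fin N) (g : Fin n → ℕ) {a b : Fin N} (a≢b : a ≢ b) where

  cl-relabel-target : cl (relabel a b ∘ rep) g b ≡ cl rep g a + cl rep g b
  cl-relabel-target = trans (sum-cong-≗ pointwise)
    (∑-distrib-+ (λ v → χ (rep v ≟ a) * g v) (λ v → χ (rep v ≟ b) * g v))
    where
    pointwise : ∀ v → χ (relabel a b (rep v) ≟ b) * g v ≡ χ (rep v ≟ a) * g v + χ (rep v ≟ b) * g v
    pointwise v with rep v ≟ a
    ... | yes refl rewrite χ-yes (b ≟ b) refl | χ-no (rep v ≟ b) a≢b = sym (+-identityʳ _)
    ... | no _ = refl

  cl-relabel-source : cl (relabel a b ∘ rep) g a ≡ 0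
  cl-relabel-source = sum-zero pointwise
    where
    pointwise : ∀ v → χ (relabel a b (rep v) ≟ a) * g v ≡ 0
    pointwise v with rep v ≟ a
    ... | yes refl rewrite χ-no (b ≟ rep v) (a≢b ∘ sym) = refl
    ... | no r≢a rewrite χ-no (rep v ≟ a) r≢a = refl

  cl-relabel-other : ∀ {c} → c ≢ a → c ≢ b → cl (relabel a b ∘ rep) g c ≡ cl rep g c
  cl-relabel-other {c} c≢a c≢b = sum-cong-≗ pointwise
    where
    pointwise : ∀ v → χ (relabel a b (rep v) ≟ c) * g v ≡ χ (rep v ≟ c) * g v
    pointwise v with rep v ≟ a
    ... | yes refl rewrite χ-no (b ≟ c) (c≢b ∘ sym) | χ-no (rep v ≟ c) (c≢a ∘ sym) = refl
    ... | no _ = refl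

-- Balanced blocks of servers

sum-χ-*′ : ∀ {n} (a : Fin n) (f : Fin n → ℕ) → sum (λ i → χ (i ≟ a) * f i) ≡ f a
sum-χ-*′ a f = trans (sum-cong-≗ (λ i → cong (_* f i) (χ-cong (i ≟ a) (a ≟ i) sym sym))) (sum-χ-* a f)

-- Functoriality of the pushforward: loads of servers can be computed component by component, and
-- block sums server by server.
cl-∘ : ∀ {n N L} (f : Fin N → Fin L) (rep : Fin n → Fin N) (g : Fin n → ℕ) c →
  cl (f ∘ rep) g c ≡ cl f (cl rep g) c
cl-∘ f rep g c = begin
  sum (λ v → χ (f (rep v) ≟ c) * g v)                        ≡⟨ sum-cl rep (λ i v → χ (f i ≟ c) * g v) ⟨
  sum (λ i → cl rep (λ v → χ (f i ≟ c) * g v) i)             ≡⟨ sum-cong-≗ (λ i → cl-*ˡ rep (χ (f i ≟ c)) g i) ⟩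
  sum (λ i → χ (f i ≟ c) * cl rep g i)                       ∎
  where open ≡-Reasoning

sum-cl-total : ∀ {n N} (rep : Fin n → Fin N) (g : Fin n → ℕ) → sum (cl rep g) ≡ sum g
sum-cl-total rep g = sum-cl rep (λ _ → g)

sum-≡-pointwise : ∀ {n} {f g : Fin n → ℕ} → (∀ i → f i ≤ g i) → sum f ≡ sum g → ∀ i → f i ≡ g i
sum-≡-pointwise f≤g eq i with m≤n⇒m<n∨m≡n (f≤g i)
... | inj₁ lt = contradiction eq (<⇒≢ (sum-strict f≤g i lt))
... | inj₂ e  = e

sum-≡-exists-< : ∀ {n} {f g : Fin n → ℕ} → sum f ≡ sum g → ∀ c → g c < f c → ∃ λ d → f d < g d
sum-≡-exists-< {f = f} {g} eq c gc<fc with any? (λ d → f d <? g d)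
... | yes found = found
... | no none   = contradiction (sym eq) (<⇒≢ (sum-strict (λ i → ≮⇒≥ (λ lt → none (i , lt))) c gc<fc))

-- Bound on the block sizes when values at least `-a` are brought to zero: the round that lowers the
-- top value from `b + 1` to `b` replaces the size bound `S` by `S (a + 1) + S b`.
roundsBound : ℕ → ℕ → ℕ → ℕ
roundsBound a zero    S = S
roundsBound a (suc b) S = roundsBound a b (S * suc a + S * b)

-- Values are the differences x − y; z is the size of a block.
module Balancing {N} (x y z : Fin N → ℕ) (total : sum x ≡ sum y) where

  private
    merge-pointwise : ∀ {q} (Q : ℕ → ℕ → ℕ → Set q) (f : Fin N → Fin N) {c d} → c ≢ d →
      (∀ i → Q (cl f x i) (cl f y i) (cl f z i)) → Q 0 0 0 →
      Q (cl f x c + cl f x d) (cl f y c + cl f y d) (cl f z c + cl f z d) →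
      ∀ i → Q (cl (relabel c d ∘ f) x i) (cl (relabel c d ∘ f) y i) (cl (relabel c d ∘ f) z i)
    merge-pointwise Q f {c} {d} c≢d old empty merged i with i ≟ c | i ≟ d
    ... | yes refl | _ rewrite cl-relabel-source f x c≢d | cl-relabel-source f y c≢d | cl-relabel-source f z c≢d = empty
    ... | no _ | yes refl rewrite cl-relabel-target f x c≢d | cl-relabel-target f y c≢d | cl-relabel-target f z c≢d = merged
    ... | no i≢c | no i≢d rewrite cl-relabel-other f x c≢d i≢c i≢d | cl-relabel-other f y c≢d i≢c i≢d | cl-relabel-other f z c≢d i≢c i≢d = old i

  module Round (a b S : ℕ) where

    -- In terms of the value `v = x - y`: `-a ≤ v ≤ b + 1` and the size is at most `S (a + 1 + v)`.
    -- The linear bound survives merges because a top block adds at most `S` to the size and at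
    -- least one to the value.
    Q : ℕ → ℕ → ℕ → Set
    Q x y z = x ≤ y + suc b × y ≤ x + a × z + S * y ≤ S * suc a + S * x × (x ≡ y + suc b → z ≤ S)

    excess : (Fin N → Fin N) → ℕ
    excess f = sum (λ i → cl f x i ∸ cl f y i)

    Q-empty : Q 0 0 0
    Q-empty = z≤n , z≤n , ≤-trans (≤-reflexive (*-zeroʳ S)) z≤n , λ ()

    -- A block of value suc b is as small as an original one, because any merged block has a smaller value.
    Q-merge : ∀ {xc yc zc xd yd zd} → Q xc yc zc → Q xd yd zd → xc ≡ yc + suc b → xd < yd →
      Q (xc + xd) (yc + yd) (zc + zd)
    Q-merge {yc = yc} {zc} {xd} {yd} {zd} (_ , _ , _ , top) (_ , low , size , _) refl xd<yd =
      <⇒≤ strict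
      , ≤-by-rearrange (yc + yd) (yc + (xd + a + suc b)) (+-monoʳ-≤ yc (≤-trans low (m≤m+n (xd + a) (suc b)))) refl (solve (yc ∷ xd ∷ a ∷ b ∷ []))
      , ≤-by-rearrange (zc + S * yc + (zd + S * yd)) (S * suc b + S * yc + (S * suc a + S * xd))
          (+-mono-≤ (+-monoˡ-≤ (S * yc) (≤-trans (top refl) (m≤m*n S (suc b)))) size)
          (solve (zc ∷ zd ∷ S ∷ yc ∷ yd ∷ [])) (solve (S ∷ a ∷ yc ∷ b ∷ xd ∷ []))
      , λ e → contradiction e (<⇒≢ strict)
      where
      strict : yc + suc b + xd < yc + yd + suc b
      strict = ≤-by-rearrange (yc + suc b + suc xd) (yc + suc b + yd) (+-monoʳ-≤ (yc + suc b) xd<yd) (solve (yc ∷ b ∷ xd ∷ [])) (solve (yc ∷ b ∷ yd ∷ []))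

    -- Before the merge the two blocks contribute `b + 1` and `0`; the merged block has value at
    -- most `b`.
    excess-merge : ∀ (f : Fin N → Fin N) {c d} → c ≢ d → cl f x c ≡ cl f y c + suc b → cl f x d < cl f y d →
      excess (relabel c d ∘ f) < excess f
    excess-merge f {c} {d} c≢d top neg = ≤-trans (≤-reflexive (+-comm 1 _))
      (sum-mono-pair {a = c} {b = d} 1 c≢d
        (λ i i≢c i≢d → ≤-reflexive (cong₂ _∸_ (cl-relabel-other f x c≢d i≢c i≢d) (cl-relabel-other f y c≢d i≢c i≢d)))
        pair)
      where
      xc = cl f x c
      yc = cl f y c
      xd = cl f x d
      yd = cl f y d
      pair : (cl (relabel c d ∘ f) x c ∸ cl (relabel c d ∘ f) y c) + (cl (relabel c d ∘ f) x d ∸ cl (relabel c d ∘ f) y d) + 1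
           ≤ (xc ∸ yc) + (xd ∸ yd)
      pair rewrite cl-relabel-source f x c≢d | cl-relabel-source f y c≢d | cl-relabel-target f x c≢d | cl-relabel-target f y c≢d | top
        | m+n∸m≡n (cl f y c) (suc b) | m≤n⇒m∸n≡0 (<⇒≤ neg) | +-assoc (cl f y c) (suc b) (cl f x d)
        | [m+n]∸[m+o]≡n∸o (cl f y c) (suc b + cl f x d) (cl f y d)
        | +-identityʳ b | +-comm (suc b + cl f x d ∸ cl f y d) 1
        = s≤s (m≤n+o⇒m∸n≤o (suc b + cl f x d) (cl f y d) (≤-trans (≤-reflexive (sym (+-suc b (cl f x d)))) (≤-trans (+-monoʳ-≤ b neg) (≤-reflexive (+-comm b (cl f y d))))))

    round : ∀ fuel (f : Fin N → Fin N) → excess f ≤ fuel → (∀ i → Q (cl f x i) (cl f y i) (cl f z i)) →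
      ∃ λ (f′ : Fin N → Fin N) → ∀ i → cl f′ x i ≤ cl f′ y i + b × cl f′ y i ≤ cl f′ x i + a × cl f′ z i ≤ S * suc a + S * b
    round fuel f e≤ q with any? (λ i → cl f x i ≟ℕ cl f y i + suc b)
    ... | no none = f , λ i → finish i (q i)
      where
      finish : ∀ i → Q (cl f x i) (cl f y i) (cl f z i) →
        cl f x i ≤ cl f y i + b × cl f y i ≤ cl f x i + a × cl f z i ≤ S * suc a + S * b
      finish i (up , low , size , _) = up′ , low ,
        +-cancelʳ-≤ (S * cl f y i) _ _ (≤-trans size (≤-trans (+-monoʳ-≤ (S * suc a) (*-monoʳ-≤ S up′)) (≤-reflexive (arith S a (cl f y i) b))))
        where
        up′ : cl f x i ≤ cl f y i + b
        up′ = m<1+n⇒m≤n (≤-trans (≤∧≢⇒< up (λ e → none (i , e))) (≤-reflexive (+-suc _ b)))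
        arith : ∀ S a y b → S * suc a + S * (y + b) ≡ S * suc a + S * b + S * y
        arith = solve-∀
    round fuel f e≤ q | yes (c , top)
      -- The values sum to zero, so a block of positive value forces one of negative value.
      with sum-≡-exists-< (trans (sum-cl-total f x) (trans total (sym (sum-cl-total f y)))) c
             (≤-trans (m<m+n (cl f y c) (s≤s z≤n)) (≤-reflexive (sym top)))
    ... | d , neg = continue fuel e≤
      where
      c≢d : c ≢ d
      c≢d refl = <⇒≱ neg (≤-trans (m≤m+n _ (suc b)) (≤-reflexive (sym top)))
      smaller : excess (relabel c d ∘ f) < excess f
      smaller = excess-merge f c≢d top neg
      continue : ∀ fuel → excess f ≤ fuel → ∃ λ (f′ : Fin N → Fin N) → ∀ i → cl f′ x i ≤ cl f′ y i + b × cl f′ y i ≤ cl f′ x i + a × cl f′ z i ≤ S * suc a + S * b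
      continue zero       e≤ = contradiction (≤-trans smaller e≤) λ ()
      continue (suc fuel) e≤ = round fuel (relabel c d ∘ f) (m<1+n⇒m≤n (≤-trans smaller e≤))
        (merge-pointwise Q f c≢d q Q-empty (Q-merge (q c) (q d) top neg))

  -- Each round lowers the maximal value by one. Once no value is positive, the zero total forces
  -- every value to be zero.
  rounds : ∀ a b S (f : Fin N → Fin N) → (∀ i → cl f x i ≤ cl f y i + b × cl f y i ≤ cl f x i + a × cl f z i ≤ S) →
    ∃ λ (f′ : Fin N → Fin N) → ∀ i → cl f′ x i ≡ cl f′ y i × cl f′ z i ≤ roundsBound a b S
  rounds a zero S f h = f , λ i → equal i , proj₂ (proj₂ (h i))
    where
    equal : ∀ i → cl f x i ≡ cl f y i
    equal = sum-≡-pointwise (λ i → ≤-trans (proj₁ (h i)) (≤-reflexive (+-identityʳ _)))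
      (trans (sum-cl-total f x) (trans total (sym (sum-cl-total f y))))
  rounds a (suc b) S f h with Round.round a b S _ f ≤-refl (λ i → start i (h i))
    where
    start : ∀ i → cl f x i ≤ cl f y i + suc b × cl f y i ≤ cl f x i + a × cl f z i ≤ S → Round.Q a b S (cl f x i) (cl f y i) (cl f z i)
    start i (up , low , size) = up , low ,
      ≤-trans (+-mono-≤ size (*-monoʳ-≤ S low)) (≤-reflexive (arith S a (cl f x i))) , λ _ → size
      where
      arith : ∀ S a x → S + S * (x + a) ≡ S * suc a + S * x
      arith = solve-∀
  ... | f′ , h′ = rounds a b (S * suc a + S * b) f′ h′

-- A block of at most `blockBound K J` servers has sums at most `K * blockBound K J` in the next
-- coordinate. The number of servers does not enter.
blockBound : ℕ → ℕ → ℕ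
blockBound K zero    = 1
blockBound K (suc J) = roundsBound (K * blockBound K J) (K * blockBound K J) (blockBound K J)

-- Coordinates are treated one at a time: blocks balanced in the earlier ones are the items of the
-- next balancing, and unions of balanced blocks stay balanced.
balanced-blocks : ∀ K J {N} (x y : Fin J → Fin N → ℕ) →
  (∀ j i → x j i ≤ K) → (∀ j i → y j i ≤ K) → (∀ j → sum (x j) ≡ sum (y j)) →
  ∃ λ (β : Fin N → Fin N) → (∀ j c → cl β (x j) c ≡ cl β (y j) c) × (∀ c → cl β (λ _ → 1) c ≤ blockBound K J)
balanced-blocks K zero x y x≤K y≤K total = (λ i → i) , (λ ()) , λ c → ≤-reflexive (sum-χ-*′ c (λ _ → 1))
balanced-blocks K (suc J) {N} x y x≤K y≤K total
  with balanced-blocks K J (x ∘ suc) (y ∘ suc) (x≤K ∘ suc) (y≤K ∘ suc) (total ∘ suc)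
... | β , equal , size = refine (Balancing.rounds x₀ y₀ (cl β (λ _ → 1)) total₀ (K * S) (K * S) S (λ i → i) start)
  where
  S = blockBound K J
  x₀ y₀ : Fin N → ℕ
  x₀ = cl β (x zero)
  y₀ = cl β (y zero)
  total₀ : sum x₀ ≡ sum y₀
  total₀ = trans (sum-cl-total β (x zero)) (trans (total zero) (sym (sum-cl-total β (y zero))))
  bounded : (g : Fin N → ℕ) → (∀ i → g i ≤ K) → ∀ c → cl β g c ≤ K * S
  bounded g g≤K c = ≤-trans (cl-mono β (λ i → ≤-trans (g≤K i) (≤-reflexive (sym (*-identityʳ K)))) c)
    (≤-trans (≤-reflexive (cl-*ˡ β K (λ _ → 1) c)) (*-monoʳ-≤ K (size c)))
  start : ∀ i → cl {N} {N} (λ i → i) x₀ i ≤ cl {N} {N} (λ i → i) y₀ i + K * S × cl {N} {N} (λ i → i) y₀ i ≤ cl {N} {N} (λ i → i) x₀ i + K * S × cl {N} {N} (λ i → i) (cl β (λ _ → 1)) i ≤ S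
  start i rewrite sum-χ-*′ i x₀ | sum-χ-*′ i y₀ | sum-χ-*′ i (cl β (λ _ → 1)) =
    ≤-trans (bounded (x zero) (x≤K zero) i) (m≤n+m _ (y₀ i)) , ≤-trans (bounded (y zero) (y≤K zero) i) (m≤n+m _ (x₀ i)) , size i
  refine : (∃ λ (f : Fin N → Fin N) → ∀ i → cl f x₀ i ≡ cl f y₀ i × cl f (cl β (λ _ → 1)) i ≤ roundsBound (K * S) (K * S) S) →
    ∃ λ (β : Fin N → Fin N) → (∀ j c → cl β (x j) c ≡ cl β (y j) c) × (∀ c → cl β (λ _ → 1) c ≤ blockBound K (suc J))
  refine (f , h) = f ∘ β , equal′ , λ c → ≤-trans (≤-reflexive (cl-∘ f β (λ _ → 1) c)) (proj₂ (h c))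
    where
    equal′ : ∀ j c → cl (f ∘ β) (x j) c ≡ cl (f ∘ β) (y j) c
    equal′ zero    c = trans (cl-∘ f β (x zero) c) (trans (proj₁ (h c)) (sym (cl-∘ f β (y zero) c)))
    equal′ (suc j) c = trans (cl-∘ f β (x (suc j)) c) (trans (sum-cong-≗ (λ i → cong (χ (f i ≟ c) *_) (equal j i))) (sym (cl-∘ f β (y (suc j)) c)))

-- Weight-preserving matchings

transpose-left : ∀ {n} (c d : Fin n) → Transposition.transpose c d c ≡ d
transpose-left c d with c ≟ c
... | yes _   = refl
... | no c≢c = contradiction refl c≢c

transpose-right : ∀ {n} (c d : Fin n) → Transposition.transpose c d d ≡ c
transpose-right c d with d ≟ c
... | yes d≡c = d≡c
... | no _ with d ≟ d
...   | yes _   = refl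
...   | no d≢d = contradiction refl d≢d

transpose-other : ∀ {n} {c d k : Fin n} → k ≢ c → k ≢ d → Transposition.transpose c d k ≡ k
transpose-other {c = c} {d} {k} k≢c k≢d with k ≟ c
... | yes k≡c = contradiction k≡c k≢c
... | no _ with k ≟ d
...   | yes k≡d = contradiction k≡d k≢d
...   | no _     = refl

module Matching {n} (W : Fin n → ℕ) {P Q : Fin n → Set} (P? : ∀ c → Dec (P c)) (Q? : ∀ c → Dec (Q c))
  (equal : ∀ j → 0 < j → sum (λ c → χ (P? c) * χ (W c ≟ℕ j)) ≡ sum (λ c → χ (Q? c) * χ (W c ≟ℕ j))) where

  -- A permutation enters only through the invariance of sums.
  Preserving : (Fin n → Fin n) → Set
  Preserving p = (∀ f → sum (f ∘ p) ≡ sum f) × (∀ c → W (p c) ≡ W c)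

  bad? : ∀ (p : Fin n → Fin n) c → Dec (P c × ¬ Q (p c) × 0 < W c)
  bad? p c = P? c ×-dec ¬? (Q? (p c)) ×-dec (0 <? W c)

  bad : (Fin n → Fin n) → ℕ
  bad p = sum (λ c → χ (bad? p c))

  -- Swapping the images of a bad `c` and a suitable `d` of the same weight repairs `c`; it spoils
  -- nothing, as `d` lies outside `P`.
  fix : ∀ fuel p → Preserving p → bad p ≤ fuel →
    ∃ λ p → Preserving p × (∀ c → 0 < W c → P c → Q (p c))
  fix fuel p pres b≤ with any? (bad? p)
  ... | no none = p , pres , λ c pos Pc → decidable-stable (Q? (p c)) (λ ¬Q → none (c , Pc , ¬Q , pos))
  -- Within the weight class of `c`, `P` and the preimage of `Q` under `p` have equal counts. As `c`
  -- lies only in the former, some `d` lies only in the latter.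
  ... | yes (c , Pc , ¬Qc , pos) with sum-≡-exists-< same c at-c
    where
    same : sum (λ d → χ (P? d) * χ (W d ≟ℕ W c)) ≡ sum (λ d → χ (Q? (p d)) * χ (W d ≟ℕ W c))
    same = trans (equal (W c) pos) (trans (sym (proj₁ pres (λ d → χ (Q? d) * χ (W d ≟ℕ W c))))
      (sum-cong-≗ (λ d → cong (λ w → χ (Q? (p d)) * χ (w ≟ℕ W c)) (proj₂ pres d))))
    at-c : χ (Q? (p c)) * χ (W c ≟ℕ W c) < χ (P? c) * χ (W c ≟ℕ W c)
    at-c rewrite χ-no (Q? (p c)) ¬Qc | χ-yes (P? c) Pc | χ-yes (W c ≟ℕ W c) refl = s≤s z≤n
  ... | d , lt = continue fuel b≤ (analyse lt)
    where
    analyse : χ (P? d) * χ (W d ≟ℕ W c) < χ (Q? (p d)) * χ (W d ≟ℕ W c) → ¬ P d × Q (p d) × W d ≡ W c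
    analyse lt with P? d | Q? (p d) | W d ≟ℕ W c
    ... | no ¬Pd | yes Qd | yes eq = ¬Pd , Qd , eq
    ... | yes _ | yes _ | yes _ = contradiction lt λ { (s≤s ()) }
    ... | yes _ | yes _ | no _ = contradiction lt λ ()
    ... | no _ | yes _ | no _ = contradiction lt λ ()
    ... | yes _ | no _ | _ = contradiction lt λ ()
    ... | no _ | no _ | _ = contradiction lt λ ()
    continue : ∀ fuel → bad p ≤ fuel → ¬ P d × Q (p d) × W d ≡ W c →
      ∃ λ p → Preserving p × (∀ c → 0 < W c → P c → Q (p c))
    continue fuel b≤ (¬Pd , Qd , eq) = descend fuel b≤
      where
      τ p′ : Fin n → Fin n
      τ  = Transposition.transpose c d
      p′ = p ∘ τ
      W-τ : ∀ k → W (τ k) ≡ W k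
      W-τ k = go (k ≟ c) (k ≟ d)
        where
        go : Dec (k ≡ c) → Dec (k ≡ d) → W (τ k) ≡ W k
        go (yes refl) _        = trans (cong W (transpose-left k d)) eq
        go (no _) (yes refl)   = trans (cong W (transpose-right c k)) (sym eq)
        go (no k≢c) (no k≢d) = cong W (transpose-other k≢c k≢d)
      pres′ : Preserving p′
      pres′ = (λ f → trans (sym (sum-permute (f ∘ p) (transpose c d))) (proj₁ pres f)) ,
              (λ k → trans (proj₂ pres (τ k)) (W-τ k))
      less : ∀ k → χ (bad? p′ k) ≤ χ (bad? p k)
      less k = χ-mono (bad? p′ k) (bad? p k) (go (k ≟ c) (k ≟ d))
        where
        go : Dec (k ≡ c) → Dec (k ≡ d) → P k × ¬ Q (p′ k) × 0 < W k → P k × ¬ Q (p k) × 0 < W k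
        go (yes refl) _ (_ , ¬q , _)        = contradiction (subst (Q ∘ p) (sym (transpose-left k d)) Qd) ¬q
        go (no _) (yes refl) (Pk , _)       = contradiction Pk ¬Pd
        go (no k≢c) (no k≢d) (Pk , ¬q , w) = Pk , subst (λ i → ¬ Q (p i)) (transpose-other k≢c k≢d) ¬q , w
      strict : bad p′ < bad p
      strict = sum-strict less c (subst₂ _<_
        (sym (χ-no (bad? p′ c) λ { (_ , ¬q , _) → ¬q (subst (Q ∘ p) (sym (transpose-left c d)) Qd) }))
        (sym (χ-yes (bad? p c) (Pc , ¬Qc , pos))) (s≤s z≤n))
      descend : ∀ fuel → bad p ≤ fuel → ∃ λ p → Preserving p × (∀ c → 0 < W c → P c → Q (p c))
      descend zero       b≤ = contradiction (≤-trans strict b≤) λ ()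
      descend (suc fuel) b≤ = fix fuel p′ pres′ (m<1+n⇒m≤n (≤-trans strict b≤))

  matching : ∃ λ p → Preserving p × (∀ c → 0 < W c → P c → Q (p c))
  matching = fix _ (λ c → c) ((λ _ → refl) , (λ _ → refl)) ≤-refl

χ-*-≡0 : ∀ {p} {P : Set p} (d : Dec P) x → ¬ P → χ d * x ≡ 0
χ-*-≡0 d x ¬p = cong (_* x) (χ-no d ¬p)

χ-*-≡ : ∀ {p} {P : Set p} (d : Dec P) x → P → χ d * x ≡ x
χ-*-≡ d x p = trans (cong (_* x) (χ-yes d p)) (*-identityˡ x)

-- X packs all items but b, and Y packs all items. The items on the block of servers containing Y b
-- are rearranged as in Y, up to exchanging items of equal weight.
module Repack {n L : ℕ} (G : ℕ) (w : Fin n → ℕ) (b : Fin n) (X Y : Fin n → Fin L) where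

  rest : Fin n → ℕ
  rest c = χ (¬? (c ≟ b)) * w c

  module _ (X-packs : ∀ s → cl X rest s ≤ G) (Y-packs : ∀ s → cl Y w s ≤ G) where

    private
      rest≢b : ∀ {c} → c ≢ b → rest c ≡ w c
      rest≢b {c} c≢b = χ-*-≡ (¬? (c ≟ b)) (w c) c≢b

      rest-b : rest b ≡ 0
      rest-b = χ-*-≡0 (¬? (b ≟ b)) (w b) (λ b≢b → b≢b refl)

      rest≤w : ∀ c → rest c ≤ w c
      rest≤w c = χ-*-≤ (¬? (c ≟ b)) (λ _ → ≤-refl)

      w-split : ∀ c → w c ≡ rest c + χ (b ≟ c) * w c
      w-split c with b ≟ c
      ... | yes refl = sym (trans (cong (_+ (w b + 0)) rest-b) (+-identityʳ (w b)))
      ... | no b≢c   = sym (trans (+-identityʳ (rest c)) (rest≢b (b≢c ∘ sym)))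

      -- The vector of a server: how many of its items have each weight from `1` to `G`. Heavier
      -- items do not fit, and an entry is at most `G` because each counted item weighs at least
      -- one.
      type : (Fin n → Fin L) → Fin G → Fin L → ℕ
      type U j = cl U (λ c → χ (rest c ≟ℕ suc (toℕ j)))

      type≤G : ∀ U → (∀ s → cl U rest s ≤ G) → ∀ j s → type U j s ≤ G
      type≤G U packs j s = ≤-trans (cl-mono U (λ c → small c (rest c ≟ℕ suc (toℕ j))) s) (packs s)
        where
        small : ∀ c (d : Dec (rest c ≡ suc (toℕ j))) → χ d ≤ rest c
        small c (yes e) = ≤-trans (s≤s z≤n) (≤-reflexive (sym e))
        small c (no _)  = z≤n

      Y-packs-rest : ∀ s → cl Y rest s ≤ G
      Y-packs-rest s = ≤-trans (cl-mono Y rest≤w s) (Y-packs s)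

      blocks = balanced-blocks G G (type X) (type Y) (type≤G X X-packs) (type≤G Y Y-packs-rest)
        (λ j → trans (sum-cl-total X (λ c → χ (rest c ≟ℕ suc (toℕ j)))) (sym (sum-cl-total Y (λ c → χ (rest c ≟ℕ suc (toℕ j))))))

      β : Fin L → Fin L
      β = proj₁ blocks

      In : (Fin n → Fin L) → Fin n → Set
      In U c = β (U c) ≡ β (Y b)

      equal : ∀ j → 0 < j → sum (λ c → χ (β (X c) ≟ β (Y b)) * χ (rest c ≟ℕ j)) ≡ sum (λ c → χ (β (Y c) ≟ β (Y b)) * χ (rest c ≟ℕ j))
      equal (suc j) _ with j <? G
      ... | yes j<G = subst (λ j → sum (λ c → χ (β (X c) ≟ β (Y b)) * χ (rest c ≟ℕ suc j)) ≡ sum (λ c → χ (β (Y c) ≟ β (Y b)) * χ (rest c ≟ℕ suc j)))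
        (toℕ-fromℕ< j<G)
        (trans (cl-∘ β X _ (β (Y b))) (trans (proj₁ (proj₂ blocks) (fromℕ< j<G) (β (Y b))) (sym (cl-∘ β Y _ (β (Y b))))))
      ... | no j≮G = trans (zero-for X) (sym (zero-for Y))
        where
        heavy : ∀ c → rest c ≢ suc j
        heavy c e = j≮G (≤-trans (≤-reflexive (sym e)) (≤-trans (term≤cl X rest c) (X-packs (X c))))
        zero-for : ∀ U → sum (λ c → χ (β (U c) ≟ β (Y b)) * χ (rest c ≟ℕ suc j)) ≡ 0
        zero-for U = sum-zero (λ c → trans (cong (χ (β (U c) ≟ β (Y b)) *_) (χ-no (rest c ≟ℕ suc j) (heavy c))) (*-zeroʳ (χ (β (U c) ≟ β (Y b)))))

      open Matching rest {P = In X} {Q = In Y} (λ c → β (X c) ≟ β (Y b)) (λ c → β (Y c) ≟ β (Y b)) equal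

      p : Fin n → Fin n
      p = proj₁ matching

      p-sum : ∀ f → sum (f ∘ p) ≡ sum f
      p-sum = proj₁ (proj₁ (proj₂ matching))

      p-rest : ∀ c → rest (p c) ≡ rest c
      p-rest = proj₂ (proj₁ (proj₂ matching))

      p-In : ∀ c → 0 < rest c → In X c → In Y (p c)
      p-In = proj₂ (proj₂ matching)

      -- Inside the block an item takes the position that `Y` gives to its partner `p c` of equal
      -- weight. Items of weight zero stay, since they do not affect the packing.
      place : ∀ c → Dec (c ≡ b) → Dec (0 < rest c × In X c) → Fin L
      place c (yes _) _       = Y b
      place c (no _)  (yes _) = Y (p c)
      place c (no _)  (no _)  = X c

    repacked : Fin n → Fin L
    repacked c = place c (c ≟ b) ((0 <? rest c) ×-dec (β (X c) ≟ β (Y b)))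

    -- A server of the block carries, through `p`, at most its weight under `Y`; on any other server
    -- no positive weight arrives.
    repacked-packs : ∀ s → cl repacked w s ≤ G
    repacked-packs s with β s ≟ β (Y b)
    ... | yes s∈I = ≤-trans (sum-mono (λ c → pointwise c (c ≟ b) ((0 <? rest c) ×-dec (β (X c) ≟ β (Y b))))) (≤-trans (≤-reflexive total) (Y-packs s))
      where
      bound : Fin n → ℕ
      bound c = χ (b ≟ c) * (χ (Y c ≟ s) * w c) + χ (Y (p c) ≟ s) * rest (p c)
      pointwise : ∀ c d e → χ (place c d e ≟ s) * w c ≤ bound c
      pointwise c (yes refl) e = ≤-trans (≤-reflexive (sym (χ-*-≡ (b ≟ b) _ refl))) (m≤m+n _ _)
      pointwise c (no c≢b) (yes _) = ≤-trans (≤-reflexive (cong (χ (Y (p c) ≟ s) *_) (trans (sym (rest≢b c≢b)) (sym (p-rest c))))) (m≤n+m _ _)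
      pointwise c (no c≢b) (no ¬moved) = χ-*-≤ (X c ≟ s) λ { refl →
        ≤-trans (≤-reflexive (sym (rest≢b c≢b))) (≤-trans (≮⇒≥ (λ pos → ¬moved (pos , s∈I))) z≤n) }
      total : sum bound ≡ cl Y w s
      total = begin
        sum bound ≡⟨ ∑-distrib-+ (λ c → χ (b ≟ c) * (χ (Y c ≟ s) * w c)) (λ c → χ (Y (p c) ≟ s) * rest (p c)) ⟩
        sum (λ c → χ (b ≟ c) * (χ (Y c ≟ s) * w c)) + sum (λ c → χ (Y (p c) ≟ s) * rest (p c))
          ≡⟨ cong (sum (λ c → χ (b ≟ c) * (χ (Y c ≟ s) * w c)) +_) (p-sum (λ c → χ (Y c ≟ s) * rest c)) ⟩
        sum (λ c → χ (b ≟ c) * (χ (Y c ≟ s) * w c)) + sum (λ c → χ (Y c ≟ s) * rest c)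
          ≡⟨ ∑-distrib-+ (λ c → χ (b ≟ c) * (χ (Y c ≟ s) * w c)) (λ c → χ (Y c ≟ s) * rest c) ⟨
        sum (λ c → χ (b ≟ c) * (χ (Y c ≟ s) * w c) + χ (Y c ≟ s) * rest c)
          ≡⟨ sum-cong-≗ (λ c → trans (arith (χ (b ≟ c)) (χ (Y c ≟ s)) (w c) (rest c)) (cong (χ (Y c ≟ s) *_) (sym (w-split c)))) ⟩
        cl Y w s ∎
        where
        open ≡-Reasoning
        arith : ∀ d e x r → d * (e * x) + e * r ≡ e * (r + d * x)
        arith = solve-∀
    ... | no s∉I = ≤-trans (sum-mono (λ c → pointwise c (c ≟ b) ((0 <? rest c) ×-dec (β (X c) ≟ β (Y b))))) (X-packs s)
      where
      pointwise : ∀ c d e → χ (place c d e ≟ s) * w c ≤ χ (X c ≟ s) * rest c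
      pointwise c (yes refl) e = ≤-trans (≤-reflexive (χ-*-≡0 (Y b ≟ s) (w b) λ { refl → s∉I refl })) z≤n
      pointwise c (no c≢b) (yes (pos , In-c)) = ≤-trans (≤-reflexive (χ-*-≡0 (Y (p c) ≟ s) (w c) λ { refl → s∉I (p-In c pos In-c) })) z≤n
      pointwise c (no c≢b) (no _) = ≤-reflexive (cong (χ (X c ≟ s) *_) (sym (rest≢b c≢b)))

    -- Each moved item other than `b` weighs at least one and comes from the block, whose boundedly
    -- many servers carry at most `G` each.
    repacked-moves : sum (λ c → χ (¬? (c ≟ b)) * χ (¬? (X c ≟ repacked c))) ≤ blockBound G G * G
    repacked-moves = begin
      sum (λ c → χ (¬? (c ≟ b)) * χ (¬? (X c ≟ repacked c)))
        ≤⟨ sum-mono (λ c → pointwise c (c ≟ b) ((0 <? rest c) ×-dec (β (X c) ≟ β (Y b)))) ⟩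
      cl (β ∘ X) rest (β (Y b))                    ≡⟨ cl-∘ β X rest (β (Y b)) ⟩
      cl β (cl X rest) (β (Y b))                   ≤⟨ cl-mono β (λ s → ≤-trans (X-packs s) (≤-reflexive (sym (*-identityʳ G)))) (β (Y b)) ⟩
      cl β (λ _ → G * 1) (β (Y b))                 ≡⟨ cl-*ˡ β G (λ _ → 1) (β (Y b)) ⟩
      G * cl β (λ _ → 1) (β (Y b))                 ≤⟨ *-monoʳ-≤ G (proj₂ (proj₂ blocks) (β (Y b))) ⟩
      G * blockBound G G                           ≡⟨ *-comm G (blockBound G G) ⟩
      blockBound G G * G                           ∎
      where
      open ≤-Reasoning
      pointwise : ∀ c (d : Dec (c ≡ b)) e → χ (¬? d) * χ (¬? (X c ≟ place c d e)) ≤ χ (β (X c) ≟ β (Y b)) * rest c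
      pointwise c (yes _) e = z≤n
      pointwise c (no _) (yes (pos , In-c)) = ≤-trans (≤-trans (≤-reflexive (*-identityˡ _)) (≤-trans (χ≤1 (¬? (X c ≟ Y (p c)))) pos))
        (≤-reflexive (sym (χ-*-≡ (β (X c) ≟ β (Y b)) (rest c) In-c)))
      pointwise c (no _) (no _) = ≤-trans (≤-reflexive (trans (*-identityˡ _) (χ-no (¬? (X c ≟ X c)) (λ ne → ne refl)))) z≤n

-- Logarithms and weights

x<2^[1+⌊log₂x⌋] : ∀ x → x < 2 ^ suc ⌊log₂ x ⌋
x<2^[1+⌊log₂x⌋] x = ≰⇒> λ le → <⇒≱ (n<1+n ⌊log₂ x ⌋)
  (≤-trans (≤-reflexive (sym (⌊log₂[2^n]⌋≡n (suc ⌊log₂ x ⌋)))) (⌊log₂⌋-mono-≤ le))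

2^⌊log₂x⌋≤x : ∀ x → 0 < x → 2 ^ ⌊log₂ x ⌋ ≤ x
2^⌊log₂x⌋≤x = <-rec _ step
  where
  step : ∀ x → (∀ {y} → y < x → 0 < y → 2 ^ ⌊log₂ y ⌋ ≤ y) → 0 < x → 2 ^ ⌊log₂ x ⌋ ≤ x
  step 1             rec _ = ≤-refl
  step x@(suc (suc y)) rec _ = begin
    2 ^ ⌊log₂ x ⌋               ≡⟨ cong (2 ^_) (suc-pred-log (⌊log₂⌋-mono-≤ {2} {x} (s≤s (s≤s z≤n)))) ⟩
    2 * 2 ^ (⌊log₂ x ⌋ ∸ 1)     ≡⟨ cong (λ r → 2 * 2 ^ r) (⌊log₂⌊n/2⌋⌋≡⌊log₂n⌋∸1 x) ⟨
    2 * 2 ^ ⌊log₂ h ⌋           ≤⟨ *-monoʳ-≤ 2 (rec {h} (⌊n/2⌋<n (suc y)) (s≤s z≤n)) ⟩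
    2 * h                       ≡⟨ cong (h +_) (+-identityʳ h) ⟩
    h + h                       ≤⟨ +-monoʳ-≤ h (⌊n/2⌋≤⌈n/2⌉ x) ⟩
    h + ⌈ x /2⌉                 ≡⟨ ⌊n/2⌋+⌈n/2⌉≡n x ⟩
    x                           ∎
    where
    open ≤-Reasoning
    h = ⌊ x /2⌋
    suc-pred-log : ∀ {r} → 1 ≤ r → r ≡ suc (r ∸ 1)
    suc-pred-log (s≤s _) = refl

-- The small-to-large principle: the component containing the smaller part at least doubles.
log-grows : ∀ {a b} → 0 < a → a ≤ b → suc ⌊log₂ a ⌋ ≤ ⌊log₂ (a + b) ⌋
log-grows {a} {b} pos a≤b = ≤-trans (≤-reflexive (sym (⌊log₂[2*b]⌋≡1+⌊log₂b⌋ a {{>-nonZero pos}})))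
  (⌊log₂⌋-mono-≤ (≤-trans (≤-reflexive (cong (a +_) (+-identityʳ a))) (+-monoʳ-≤ a a≤b)))

-- Twice the weight, minus one for a component of positive weight: the total grows with every merge that
-- raises the total weight or joins two components of positive weight.
eventPotential : ℕ → ℕ
eventPotential zero    = 0
eventPotential (suc w) = suc (w + w)

eventPotential≤ : ∀ w → eventPotential w ≤ w + w
eventPotential≤ zero    = z≤n
eventPotential≤ (suc w) = s≤s (≤-trans (n≤1+n (w + w)) (≤-reflexive (sym (+-suc w w))))

-- If `x` is zero, the weight rises by at least one, which gains two and loses at most one.
-- Otherwise two deductions of one are replaced by a single one.
eventPotential-merge : ∀ {x y w} → x ≤ y → x + y ≤ w → ¬ (x ≡ 0 × w ≡ y) →
  eventPotential x + eventPotential y + 1 ≤ eventPotential w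
eventPotential-merge {zero} {y} {w} _ y≤w event = go (≤∧≢⇒< y≤w (λ e → event (refl , sym e)))
  where
  go : ∀ {w} → y < w → eventPotential y + 1 ≤ eventPotential w
  go {suc w} (s≤s y≤w) = ≤-trans (+-monoˡ-≤ 1 (eventPotential≤ y)) (≤-trans (≤-reflexive (+-comm (y + y) 1)) (s≤s (+-mono-≤ y≤w y≤w)))
eventPotential-merge {suc x} {suc y} {suc w} _ (s≤s xy≤w) _ =
  ≤-by-rearrange (suc ((x + suc y) + (x + suc y))) (suc (w + w)) (s≤s (+-mono-≤ xy≤w xy≤w)) (arith x y) refl
  where
  arith : ∀ x y → suc (x + x) + suc (y + y) + 1 ≡ suc ((x + suc y) + (x + suc y))
  arith = solve-∀

module Weight (m k : ℕ) .{{_ : NonZero k}} (m>0 : 0 < m) where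

  threshold : ℕ → ℕ
  threshold y with m ≤? y
  ... | yes _ = y
  ... | no _  = 0

  threshold≤ : ∀ y → threshold y ≤ y
  threshold≤ y with m ≤? y
  ... | yes _ = ≤-refl
  ... | no _  = z≤n

  threshold-pos : ∀ y → 0 < threshold y → m ≤ y × threshold y ≡ y
  threshold-pos y pos with m ≤? y
  ... | yes m≤y = m≤y , refl

  threshold-zero : ∀ y → threshold y ≡ 0 → y < m
  threshold-zero y e with m ≤? y
  ... | yes m≤y = contradiction (≤-trans m>0 m≤y) (≤⇒≯ (≤-reflexive e))
  ... | no m≰y  = ≰⇒> m≰y

  threshold-≥ : ∀ {y z} → m ≤ y → y ≤ z → y ≤ threshold z
  threshold-≥ {y} {z} m≤y y≤z with m ≤? z
  ... | yes _   = y≤z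
  ... | no m≰z = contradiction (≤-trans m≤y y≤z) m≰z

  threshold-superadditive : ∀ y z → threshold y + threshold z ≤ threshold (y + z)
  threshold-superadditive y z with m ≤? y | m ≤? z
  ... | yes m≤y | yes _   = threshold-≥ (≤-trans m≤y (m≤m+n y z)) ≤-refl
  ... | yes m≤y | no _    = ≤-trans (≤-reflexive (+-identityʳ y)) (threshold-≥ m≤y (m≤m+n y z))
  ... | no _    | yes m≤z = threshold-≥ m≤z (m≤n+m z y)
  ... | no _    | no _    = z≤n

  threshold-mono : ∀ {y z} → y ≤ z → threshold y ≤ threshold z
  threshold-mono {y} y≤z with m ≤? y
  ... | yes m≤y = threshold-≥ m≤y y≤z
  ... | no _    = z≤n

  G : ℕ
  G = m * m

  -- The size in units of k / m², rounded down, or 0 for a small component (fewer than k / m vertices).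
  weight : ℕ → ℕ
  weight x = threshold (x * G div k)

  weight-0 : weight 0 ≡ 0
  weight-0 = n≤0⇒n≡0 (≤-trans (threshold≤ (0 div k)) (≤-reflexive (0/n≡0 k)))

  weight-*k≤ : ∀ x → weight x * k ≤ x * G
  weight-*k≤ x = ≤-trans (*-monoˡ-≤ k (threshold≤ (x * G div k))) (m/n*n≤m (x * G) k)

  private
    upper : ∀ x → x * G ≤ suc (x * G div k) * k
    upper x = ≤-trans (≤-reflexive (m≡m%n+[m/n]*n (x * G) k)) (+-monoˡ-≤ (x * G div k * k) (<⇒≤ (m%n<n (x * G) k)))

  -- Rounding down loses less than one unit out of at least `m`, hence at most a factor `1 + 1/m`.
  weight-pos : ∀ x → 0 < weight x → m * G * x ≤ suc m * k * weight x
  weight-pos x pos with threshold-pos (x * G div k) pos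
  ... | m≤y , e rewrite e = begin
    m * G * x                         ≡⟨ arith₁ m G x ⟩
    m * (x * G)                       ≤⟨ *-monoʳ-≤ m (upper x) ⟩
    m * (suc y * k)                   ≡⟨ arith₂ m y k ⟩
    m * k * y + m * k                 ≤⟨ +-monoʳ-≤ (m * k * y) (*-monoˡ-≤ k m≤y) ⟩
    m * k * y + y * k                 ≡⟨ arith₃ m y k ⟩
    suc m * k * y                     ∎
    where
    open ≤-Reasoning
    y = x * G div k
    arith₁ : ∀ m G x → m * G * x ≡ m * (x * G)
    arith₁ = solve-∀
    arith₂ : ∀ m y k → m * (suc y * k) ≡ m * k * y + m * k
    arith₂ = solve-∀
    arith₃ : ∀ m y k → m * k * y + y * k ≡ suc m * k * y
    arith₃ = solve-∀

  weight-zero : ∀ x → weight x ≡ 0 → m * x ≤ k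
  weight-zero x e = *-cancelʳ-≤ (m * x) k m {{>-nonZero m>0}} (begin
    m * x * m                 ≡⟨ arith m x ⟩
    x * G                     ≤⟨ upper x ⟩
    suc (x * G div k) * k       ≤⟨ *-monoˡ-≤ k (threshold-zero (x * G div k) e) ⟩
    m * k                     ≡⟨ *-comm m k ⟩
    k * m                     ∎)
    where
    open ≤-Reasoning
    arith : ∀ m x → m * x * m ≡ x * (m * m)
    arith = solve-∀

  -- Rounding down and cutting off small values are both superadditive, so merging never lowers the
  -- total weight and weight changes can be counted by a potential.
  weight-superadditive : ∀ x y → weight x + weight y ≤ weight (x + y)
  weight-superadditive x y = ≤-trans (threshold-superadditive (x * G div k) (y * G div k)) (threshold-mono
    (≤-trans (≤-reflexive (sym (m*n/n≡m (x * G div k + y * G div k) k))) (/-monoˡ-≤ k (begin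
      (x * G div k + y * G div k) * k            ≡⟨ *-distribʳ-+ k (x * G div k) (y * G div k) ⟩
      x * G div k * k + y * G div k * k          ≤⟨ +-mono-≤ (m/n*n≤m (x * G) k) (m/n*n≤m (y * G) k) ⟩
      x * G + y * G                          ≡⟨ *-distribʳ-+ G x y ⟨
      (x + y) * G                            ∎))))
    where open ≤-Reasoning

  weight-mono : ∀ {x y} → x ≤ y → weight x ≤ weight y
  weight-mono {x} {y} x≤y = ≤-trans (m≤m+n (weight x) (weight (y ∸ x)))
    (≤-trans (weight-superadditive x (y ∸ x)) (≤-reflexive (cong weight (m+[n∸m]≡n x≤y))))

-- Configurations

sum-1 : ∀ n → sum {n} (λ _ → 1) ≡ n
sum-1 n = trans (sum-const n 1) (*-identityʳ n)

module _ {ℓ n : ℕ} where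

  load-cl : (σ : Config ℓ n) (s : Fin ℓ) → load σ s ≡ cl σ (λ _ → 1) s
  load-cl σ s = trans (length-filter-tabulate (λ v → σ v ≟ s) (λ v → v)) (sum-cong-≗ (λ v → sym (*-identityʳ (χ (σ v ≟ s)))))

  moves-sum : (σ τ : Config ℓ n) → moves σ τ ≡ sum (λ v → χ (¬? (σ v ≟ τ v)))
  moves-sum σ τ = length-filter-tabulate (λ v → ¬? (σ v ≟ τ v)) (λ v → v)

  load-total : (σ : Config ℓ n) → sum (load σ) ≡ n
  load-total σ = trans (sum-cong-≗ (load-cl σ)) (trans (sum-cl-total σ (λ _ → 1)) (sum-1 n))

  load-cong : {σ τ : Config ℓ n} → (∀ v → σ v ≡ τ v) → ∀ s → load σ s ≡ load τ s
  load-cong {σ} {τ} eq s = trans (load-cl σ s) (trans (sum-cong-≗ (λ v → cong (λ t → χ (t ≟ s) * 1) (eq v))) (sym (load-cl τ s)))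

  moves-refl : (σ : Config ℓ n) → moves σ σ ≡ 0
  moves-refl σ = trans (moves-sum σ σ) (sum-zero (λ v → χ-no (¬? (σ v ≟ σ v)) (λ ne → ne refl)))

  moves-cong : {σ σ′ τ τ′ : Config ℓ n} → (∀ v → σ v ≡ σ′ v) → (∀ v → τ v ≡ τ′ v) → moves σ τ ≡ moves σ′ τ′
  moves-cong {σ} {σ′} {τ} {τ′} p q = trans (moves-sum σ τ)
    (trans (sum-cong-≗ (λ v → cong₂ (λ s t → χ (¬? (s ≟ t))) (p v) (q v))) (sym (moves-sum σ′ τ′)))

  moves-≤ : (σ τ : Config ℓ n) → moves σ τ ≤ n
  moves-≤ σ τ = ≤-trans (≤-reflexive (moves-sum σ τ))
    (≤-trans (sum-mono (λ v → χ≤1 (¬? (σ v ≟ τ v)))) (≤-reflexive (sum-1 n)))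

  moves-triangle : (σ τ υ : Config ℓ n) → moves σ υ ≤ moves σ τ + moves τ υ
  moves-triangle σ τ υ = begin
    moves σ υ
      ≡⟨ moves-sum σ υ ⟩
    sum (λ v → χ (¬? (σ v ≟ υ v)))
      ≤⟨ sum-mono pointwise ⟩
    sum (λ v → χ (¬? (σ v ≟ τ v)) + χ (¬? (τ v ≟ υ v)))
      ≡⟨ ∑-distrib-+ (λ v → χ (¬? (σ v ≟ τ v))) (λ v → χ (¬? (τ v ≟ υ v))) ⟩
    sum (λ v → χ (¬? (σ v ≟ τ v))) + sum (λ v → χ (¬? (τ v ≟ υ v)))
      ≡⟨ cong₂ _+_ (moves-sum σ τ) (moves-sum τ υ) ⟨
    moves σ τ + moves τ υ ∎
    where
    open ≤-Reasoning
    pointwise : ∀ v → χ (¬? (σ v ≟ υ v)) ≤ χ (¬? (σ v ≟ τ v)) + χ (¬? (τ v ≟ υ v))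
    pointwise v with σ v ≟ τ v
    ... | yes e = ≤-reflexive (cong (λ s → χ (¬? (s ≟ υ v))) e)
    ... | no _  = ≤-trans (χ≤1 (¬? (σ v ≟ υ v))) (s≤s z≤n)

  load-moves : (σ τ : Config ℓ n) (s : Fin ℓ) →
    load τ s ≤ load σ s + cl τ (λ v → χ (¬? (σ v ≟ τ v))) s
  load-moves σ τ s = begin
    load τ s        ≡⟨ load-cl τ s ⟩
    cl τ (λ _ → 1) s ≤⟨ sum-mono pointwise ⟩
    sum (λ v → χ (σ v ≟ s) * 1 + χ (τ v ≟ s) * χ (¬? (σ v ≟ τ v)))
      ≡⟨ ∑-distrib-+ (λ v → χ (σ v ≟ s) * 1) (λ v → χ (τ v ≟ s) * χ (¬? (σ v ≟ τ v))) ⟩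
    cl σ (λ _ → 1) s + cl τ (λ v → χ (¬? (σ v ≟ τ v))) s
      ≡⟨ cong (_+ cl τ (λ v → χ (¬? (σ v ≟ τ v))) s) (load-cl σ s) ⟨
    load σ s + cl τ (λ v → χ (¬? (σ v ≟ τ v))) s ∎
    where
    open ≤-Reasoning
    pointwise : ∀ v → χ (τ v ≟ s) * 1 ≤ χ (σ v ≟ s) * 1 + χ (τ v ≟ s) * χ (¬? (σ v ≟ τ v))
    pointwise v with σ v ≟ τ v
    ... | yes e = ≤-trans (≤-reflexive (cong (λ t → χ (t ≟ s) * 1) (sym e))) (m≤m+n _ _)
    ... | no _  = m≤n+m _ _

  cl-moves≤ : (σ τ : Config ℓ n) (s : Fin ℓ) → cl τ (λ v → χ (¬? (σ v ≟ τ v))) s ≤ moves σ τ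
  cl-moves≤ σ τ s = ≤-trans (sum-mono (λ v → χ-*-≤ (τ v ≟ s) (λ _ → ≤-refl))) (≤-reflexive (sym (moves-sum σ τ)))

  -- Loads are scaled by `m` so that thresholds such as `(1 + 1/m) k` are integers.
  overload : ℕ → ℕ → Config ℓ n → ℕ
  overload m K σ = sum (λ s → m * load σ s ∸ K)

  overload-moves : ∀ m K (σ τ : Config ℓ n) → overload m K τ ≤ overload m K σ + m * moves σ τ
  overload-moves m K σ τ = begin
    overload m K τ
      ≤⟨ sum-mono pointwise ⟩
    sum (λ s → (m * load σ s ∸ K) + m * cl τ moved s)
      ≡⟨ ∑-distrib-+ (λ s → m * load σ s ∸ K) (λ s → m * cl τ moved s) ⟩
    overload m K σ + sum (λ s → m * cl τ moved s)
      ≡⟨ cong (overload m K σ +_) (sym (*-distribˡ-sum m (cl τ moved))) ⟩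
    overload m K σ + m * sum (cl τ moved)
      ≡⟨ cong (λ x → overload m K σ + m * x) (trans (sum-cl-total τ moved) (sym (moves-sum σ τ))) ⟩
    overload m K σ + m * moves σ τ ∎
    where
    open ≤-Reasoning
    moved : Fin n → ℕ
    moved v = χ (¬? (σ v ≟ τ v))
    pointwise : ∀ s → m * load τ s ∸ K ≤ (m * load σ s ∸ K) + m * cl τ moved s
    pointwise s = m≤n+o⇒m∸n≤o (m * load τ s) K (begin
      m * load τ s                                     ≤⟨ *-monoʳ-≤ m (load-moves σ τ s) ⟩
      m * (load σ s + cl τ moved s)                    ≡⟨ *-distribˡ-+ m (load σ s) (cl τ moved s) ⟩
      m * load σ s + m * cl τ moved s                  ≤⟨ +-monoˡ-≤ (m * cl τ moved s) (m≤n+m∸n (m * load σ s) K) ⟩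
      K + (m * load σ s ∸ K) + m * cl τ moved s        ≡⟨ +-assoc K _ _ ⟩
      K + ((m * load σ s ∸ K) + m * cl τ moved s)      ∎)

-- Exhaustive search, value by value. An arbitrary witness agrees with an enumerated function only
-- pointwise, which is why `P` must respect pointwise equality.
anyFunction? : ∀ {n L p} {P : (Fin n → Fin L) → Set p} → (∀ {f g} → (∀ i → f i ≡ g i) → P f → P g) →
  (∀ f → Dec (P f)) → Dec (∃ P)
anyFunction? {zero} {L} {P = P} resp P? with P? empty
  where
  empty : Fin 0 → Fin L
  empty ()
... | yes Pe = yes (_ , Pe)
... | no ¬Pe = no λ { (f , Pf) → ¬Pe (resp (λ ()) Pf) }
anyFunction? {suc n} {L} {P = P} resp P?
  with any? (λ x → anyFunction? {P = λ f → P (cons x f)} (λ eq → resp (cons-cong eq)) (λ f → P? (cons x f)))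
  where
  cons : Fin L → (Fin n → Fin L) → Fin (suc n) → Fin L
  cons x f zero    = x
  cons x f (suc i) = f i
  cons-cong : ∀ {x f g} → (∀ i → f i ≡ g i) → ∀ i → cons x f i ≡ cons x g i
  cons-cong eq zero    = refl
  cons-cong eq (suc i) = eq i
... | yes (x , f , Pf) = yes (_ , Pf)
... | no none = no λ { (f , Pf) → none (f zero , f ∘ suc , resp (λ { zero → refl ; (suc i) → refl }) Pf) }

relocate : ∀ {n L} → (Fin n → Fin L) → Fin n → Fin L → Fin n → Fin L
relocate loc c s d with d ≟ c
... | yes _ = s
... | no _  = loc d

relocate-hit : ∀ {n L} (loc : Fin n → Fin L) c s → relocate loc c s c ≡ s
relocate-hit loc c s with c ≟ c
... | yes _   = refl
... | no c≢c = contradiction refl c≢c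

relocate-miss : ∀ {n L} (loc : Fin n → Fin L) c s {d} → d ≢ c → relocate loc c s d ≡ loc d
relocate-miss loc c s {d} d≢c with d ≟ c
... | yes d≡c = contradiction d≡c d≢c
... | no _     = refl

module _ {n L : ℕ} (loc : Fin n → Fin L) (c : Fin n) {s s′ : Fin L} (loc-c : loc c ≡ s) (s≢s′ : s ≢ s′) (g : Fin n → ℕ) where

  private
    loc′ = relocate loc c s′

    with-c : (h : Fin n → ℕ) → sum (λ d → h d + χ (c ≟ d) * g d) ≡ sum h + g c
    with-c h = trans (∑-distrib-+ h (λ d → χ (c ≟ d) * g d)) (cong (sum h +_) (sum-χ-* c g))

  cl-relocate-source : cl loc′ g s + g c ≡ cl loc g s
  cl-relocate-source = trans (sym (with-c (λ d → χ (loc′ d ≟ s) * g d))) (sum-cong-≗ (λ d → pointwise d (c ≟ d)))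
    where
    pointwise : ∀ d (e : Dec (c ≡ d)) → χ (loc′ d ≟ s) * g d + χ e * g d ≡ χ (loc d ≟ s) * g d
    pointwise d (yes refl) rewrite relocate-hit loc c s′ | χ-no (s′ ≟ s) (s≢s′ ∘ sym) | χ-yes (loc c ≟ s) loc-c = refl
    pointwise d (no c≢d) rewrite relocate-miss loc c s′ (c≢d ∘ sym) = +-identityʳ _

  cl-relocate-target : cl loc′ g s′ ≡ cl loc g s′ + g c
  cl-relocate-target = trans (sum-cong-≗ (λ d → pointwise d (c ≟ d))) (with-c (λ d → χ (loc d ≟ s′) * g d))
    where
    pointwise : ∀ d (e : Dec (c ≡ d)) → χ (loc′ d ≟ s′) * g d ≡ χ (loc d ≟ s′) * g d + χ e * g d
    pointwise d (yes refl) rewrite relocate-hit loc c s′ | χ-yes (s′ ≟ s′) refl | χ-no (loc c ≟ s′) (λ e → s≢s′ (trans (sym loc-c) e)) = refl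
    pointwise d (no c≢d) rewrite relocate-miss loc c s′ (c≢d ∘ sym) = sym (+-identityʳ _)

  cl-relocate-other : ∀ {t} → t ≢ s → t ≢ s′ → cl loc′ g t ≡ cl loc g t
  cl-relocate-other {t} t≢s t≢s′ = sum-cong-≗ (λ d → pointwise d (c ≟ d))
    where
    pointwise : ∀ d → Dec (c ≡ d) → χ (loc′ d ≟ t) * g d ≡ χ (loc d ≟ t) * g d
    pointwise d (yes refl) rewrite relocate-hit loc c s′ | χ-no (s′ ≟ t) (t≢s′ ∘ sym) | χ-no (loc c ≟ t) (λ e → t≢s (trans (sym e) loc-c)) = refl
    pointwise d (no c≢d) rewrite relocate-miss loc c s′ (c≢d ∘ sym) = refl

-- Eviction of small components

module Eviction (ℓ k m : ℕ) .{{_ : NonZero k}} (m>0 : 0 < m) (rep : Fin (ℓ * k) → Fin (ℓ * k)) where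

  open Weight m k m>0

  size : Fin (ℓ * k) → ℕ
  size = cl rep (λ _ → 1)

  w : Fin (ℓ * k) → ℕ
  w c = weight (size c)

  Packs : Config ℓ (ℓ * k) → Set
  Packs loc = ∀ s → cl loc w s ≤ G

  load-size : (loc : Config ℓ (ℓ * k)) → ∀ s → load (loc ∘ rep) s ≡ cl loc size s
  load-size loc s = trans (load-cl (loc ∘ rep) s) (cl-∘ loc rep (λ _ → 1) s)

  -- Overload is measured above `(1 + 1/m) k`, while eviction starts only above `(1 + 2/m) k`. The
  -- gap `k / m` is at least the size of any small component.
  Φ : Config ℓ (ℓ * k) → ℕ
  Φ loc = overload m (suc m * k) (loc ∘ rep)

  -- Large components of total weight at most `m²` have total size at most `(1 + 1/m) k`, so they
  -- alone cannot cause the excess.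
  small-exists : ∀ loc s → Packs loc → suc (suc m) * k < m * load (loc ∘ rep) s →
    ∃ λ c → loc c ≡ s × w c ≡ 0 × 0 < size c
  small-exists loc s packs over with any? (λ c → (loc c ≟ s) ×-dec (w c ≟ℕ 0) ×-dec (0 <? size c))
  ... | yes found = found
  ... | no none   = contradiction over (≤⇒≯ (≤-trans (*-cancelˡ-≤ G {{>-nonZero (*-mono-≤ m>0 m>0)}} scaled) (*-monoˡ-≤ k (n≤1+n (suc m)))))
    where
    large : ∀ c → loc c ≡ s → m * G * size c ≤ suc m * k * w c
    large c at-s with size c ≟ℕ 0
    ... | yes e = ≤-trans (≤-reflexive (trans (cong (m * G *_) e) (*-zeroʳ (m * G)))) z≤n
    ... | no ne = weight-pos (size c) (n≢0⇒n>0 (λ wz → none (c , at-s , wz , n≢0⇒n>0 ne)))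
    scaled : G * (m * load (loc ∘ rep) s) ≤ G * (suc m * k)
    scaled = begin
      G * (m * load (loc ∘ rep) s)             ≡⟨ cong (λ x → G * (m * x)) (load-size loc s) ⟩
      G * (m * cl loc size s)                  ≡⟨ arith₁ G m (cl loc size s) ⟩
      m * G * cl loc size s                    ≡⟨ cl-*ˡ loc (m * G) size s ⟨
      cl loc (λ c → m * G * size c) s          ≤⟨ sum-mono (λ c → pointwise c (loc c ≟ s)) ⟩
      cl loc (λ c → suc m * k * w c) s         ≡⟨ cl-*ˡ loc (suc m * k) w s ⟩
      suc m * k * cl loc w s                   ≤⟨ *-monoʳ-≤ (suc m * k) (packs s) ⟩
      suc m * k * G                            ≡⟨ *-comm (suc m * k) G ⟩
      G * (suc m * k)                          ∎
      where
      open ≤-Reasoning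
      arith₁ : ∀ G m x → G * (m * x) ≡ m * G * x
      arith₁ = solve-∀
      pointwise : ∀ c (d : Dec (loc c ≡ s)) → χ d * (m * G * size c) ≤ χ d * (suc m * k * w c)
      pointwise c (yes e) = *-monoʳ-≤ 1 (large c e)
      pointwise c (no _)  = z≤n

  -- The average load is `k`. The argument `s` ensures that there is a server at all.
  light-exists : ∀ (σ : Config ℓ (ℓ * k)) (s : Fin ℓ) → ∃ λ s′ → load σ s′ ≤ k
  light-exists σ s with any? (λ s′ → load σ s′ ≤? k)
  ... | yes found = found
  ... | no none   = contradiction (trans (load-total σ) (sym (sum-const ℓ k)))
    (<⇒≢ (sum-strict {f = λ _ → k} (λ t → <⇒≤ (heavy t)) s (heavy s)) ∘ sym)
    where
    heavy : ∀ t → k < load σ t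
    heavy t = ≰⇒> (λ le → none (t , le))

  moves-relocate : ∀ (loc : Config ℓ (ℓ * k)) c s → moves (loc ∘ rep) (relocate loc c s ∘ rep) ≤ size c
  moves-relocate loc c s = ≤-trans (≤-reflexive (moves-sum (loc ∘ rep) (relocate loc c s ∘ rep))) (sum-mono (λ v → pointwise v (rep v ≟ c)))
    where
    pointwise : ∀ v (d : Dec (rep v ≡ c)) → χ (¬? (loc (rep v) ≟ relocate loc c s (rep v))) ≤ χ d * 1
    pointwise v (yes _) = χ≤1 (¬? (loc (rep v) ≟ relocate loc c s (rep v)))
    pointwise v (no ne) rewrite relocate-miss loc c s ne = ≤-reflexive (χ-no (¬? (loc (rep v) ≟ loc (rep v))) (λ f → f refl))

  module Step (loc : Config ℓ (ℓ * k)) (packs : Packs loc) (s s′ : Fin ℓ) (c : Fin (ℓ * k))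
    (over : suc (suc m) * k < m * load (loc ∘ rep) s) (light : load (loc ∘ rep) s′ ≤ k)
    (on-s : loc c ≡ s) (small : w c ≡ 0) where

    loc′ : Config ℓ (ℓ * k)
    loc′ = relocate loc c s′

    private
      x = size c
      K = suc m * k

      mx≤k : m * x ≤ k
      mx≤k = weight-zero x small

      s≢s′ : s ≢ s′
      s≢s′ refl = <⇒≱ over (≤-trans (*-monoʳ-≤ m light) (*-monoˡ-≤ k (≤-trans (n≤1+n m) (n≤1+n (suc m)))))

      load-s : load (loc′ ∘ rep) s + x ≡ load (loc ∘ rep) s
      load-s = trans (cong (_+ x) (load-size loc′ s)) (trans (cl-relocate-source loc c on-s s≢s′ size) (sym (load-size loc s)))

      load-s′ : load (loc′ ∘ rep) s′ ≡ load (loc ∘ rep) s′ + x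
      load-s′ = trans (load-size loc′ s′) (trans (cl-relocate-target loc c on-s s≢s′ size) (cong (_+ x) (sym (load-size loc s′))))

      source : (m * load (loc′ ∘ rep) s ∸ K) + m * x ≡ m * load (loc ∘ rep) s ∸ K
      source = begin
        (m * load (loc′ ∘ rep) s ∸ K) + m * x   ≡⟨ +-∸-comm (m * x) K≤ ⟨
        m * load (loc′ ∘ rep) s + m * x ∸ K     ≡⟨ cong (_∸ K) (*-distribˡ-+ m (load (loc′ ∘ rep) s) x) ⟨
        m * (load (loc′ ∘ rep) s + x) ∸ K       ≡⟨ cong (λ l → m * l ∸ K) load-s ⟩
        m * load (loc ∘ rep) s ∸ K              ∎
        where
        open ≡-Reasoning
        -- The scaled load exceeds `(m + 2) k`, and removing a small component lowers it by at most
        -- `k`.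
        K≤ : K ≤ m * load (loc′ ∘ rep) s
        K≤ = +-cancelʳ-≤ k _ _ (≤-trans (≤-reflexive (+-comm K k)) (≤-trans (<⇒≤ over)
          (≤-trans (≤-reflexive (trans (cong (m *_) (sym load-s)) (*-distribˡ-+ m (load (loc′ ∘ rep) s) x))) (+-monoʳ-≤ (m * load (loc′ ∘ rep) s) mx≤k))))

      target : m * load (loc′ ∘ rep) s′ ∸ K ≡ 0
      target = m≤n⇒m∸n≡0 (≤-trans (≤-reflexive (trans (cong (m *_) load-s′) (*-distribˡ-+ m (load (loc ∘ rep) s′) x)))
        (≤-trans (+-mono-≤ (*-monoʳ-≤ m light) mx≤k) (≤-reflexive (+-comm (m * k) k))))

    packs′ : Packs loc′
    packs′ t = ≤-trans (sum-mono (λ d → pointwise d (d ≟ c))) (packs t)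
      where
      pointwise : ∀ d → Dec (d ≡ c) → χ (loc′ d ≟ t) * w d ≤ χ (loc d ≟ t) * w d
      pointwise d (yes refl) = ≤-trans (≤-reflexive (trans (cong (χ (loc′ d ≟ t) *_) small) (*-zeroʳ (χ (loc′ d ≟ t))))) z≤n
      pointwise d (no d≢c) rewrite relocate-miss loc c s′ d≢c = ≤-refl

    -- The source remains above the threshold, so its overload falls by the full scaled size; the
    -- target ends at or below `(1 + 1/m) k` and has no overload.
    Φ-drop : Φ loc′ + m * x ≤ Φ loc
    Φ-drop = sum-mono-pair {a = s} {b = s′} (m * x) s≢s′
      (λ t t≢s t≢s′ → ≤-reflexive (cong (λ l → m * l ∸ K)
        (trans (load-size loc′ t) (trans (cl-relocate-other loc c on-s s≢s′ size t≢s t≢s′) (sym (load-size loc t))))))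
      pair
      where
      pair : (m * load (loc′ ∘ rep) s ∸ K) + (m * load (loc′ ∘ rep) s′ ∸ K) + m * x ≤ (m * load (loc ∘ rep) s ∸ K) + (m * load (loc ∘ rep) s′ ∸ K)
      pair rewrite target | +-identityʳ (m * load (loc′ ∘ rep) s ∸ K) | source = m≤m+n _ _

  -- The decrease of `Φ` both pays for the evictions and makes them terminate.
  evict : ∀ fuel loc → Packs loc → Φ loc ≤ fuel →
    ∃ λ loc′ → Packs loc′ × (∀ s → m * load (loc′ ∘ rep) s ≤ suc (suc m) * k) ×
      m * moves (loc ∘ rep) (loc′ ∘ rep) + Φ loc′ ≤ Φ loc
  evict fuel loc packs Φ≤ with any? (λ s → suc (suc m) * k <? m * load (loc ∘ rep) s)
  ... | no none = loc , packs , (λ s → ≮⇒≥ (λ over → none (s , over))) ,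
    ≤-reflexive (cong (_+ Φ loc) (trans (cong (m *_) (moves-refl (loc ∘ rep))) (*-zeroʳ m)))
  ... | yes (s , over) with small-exists loc s packs over | light-exists (loc ∘ rep) s
  ...   | c , on-s , small , pos | s′ , light = continue fuel Φ≤
    where
    open Step loc packs s s′ c over light on-s small
    mx>0 : 0 < m * size c
    mx>0 = *-mono-≤ m>0 pos
    smaller : Φ loc′ < Φ loc
    smaller = ≤-trans (m<m+n (Φ loc′) mx>0) Φ-drop
    continue : ∀ fuel → Φ loc ≤ fuel →
      ∃ λ loc″ → Packs loc″ × (∀ s → m * load (loc″ ∘ rep) s ≤ suc (suc m) * k) ×
        m * moves (loc ∘ rep) (loc″ ∘ rep) + Φ loc″ ≤ Φ loc
    continue zero       Φ≤ = contradiction (≤-trans smaller Φ≤) λ ()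
    continue (suc fuel) Φ≤ with evict fuel loc′ packs′ (m<1+n⇒m≤n (≤-trans smaller Φ≤))
    ... | loc″ , packs″ , cap , cost = loc″ , packs″ , cap , (begin
      m * moves (loc ∘ rep) (loc″ ∘ rep) + Φ loc″
        ≤⟨ +-monoˡ-≤ (Φ loc″) (*-monoʳ-≤ m (moves-triangle (loc ∘ rep) (loc′ ∘ rep) (loc″ ∘ rep))) ⟩
      m * (moves (loc ∘ rep) (loc′ ∘ rep) + moves (loc′ ∘ rep) (loc″ ∘ rep)) + Φ loc″
        ≡⟨ arith m (moves (loc ∘ rep) (loc′ ∘ rep)) (moves (loc′ ∘ rep) (loc″ ∘ rep)) (Φ loc″) ⟩
      m * moves (loc′ ∘ rep) (loc″ ∘ rep) + Φ loc″ + m * moves (loc ∘ rep) (loc′ ∘ rep)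
        ≤⟨ +-mono-≤ cost (*-monoʳ-≤ m (moves-relocate loc c s′)) ⟩
      Φ loc′ + m * size c
        ≤⟨ Φ-drop ⟩
      Φ loc ∎)
      where
      open ≤-Reasoning
      arith : ∀ m p q r → m * (p + q) + r ≡ m * q + r + m * p
      arith = solve-∀

-- Packing phase

module Packing (ℓ k m : ℕ) .{{_ : NonZero k}} (m>0 : 0 < m) where

  open Weight m k m>0 public

  private
    n = ℓ * k

  Labels : Set
  Labels = Fin n → Fin n

  size : Labels → Fin n → ℕ
  size rep = cl rep (λ _ → 1)

  rank : Labels → Fin n → ℕ
  rank rep c = ⌊log₂ size rep c ⌋

  -- The number of components moved in one rearrangement: those of the block, plus the merged one.
  -- Each has at most `k` vertices.
  B : ℕ
  B = blockBound G G * G + 1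

  -- The first term pays for moving smaller parts to larger ones, the second pays `B * k` for each
  -- merge that triggers a rearrangement.
  Θ : Labels → Fin n → ℕ
  Θ rep c = size rep c * rank rep c + B * k * eventPotential (weight (size rep c))

  Packs : Labels → Config ℓ n → Set
  Packs rep loc = ∀ s → cl loc (λ c → weight (size rep c)) s ≤ G

  Valid : Labels → Config ℓ n → Set
  Valid rep τ = ∀ s → load (τ ∘ rep) s ≤ k

  load-size : ∀ rep (loc : Config ℓ n) s → load (loc ∘ rep) s ≡ cl loc (size rep) s
  load-size = Eviction.load-size ℓ k m m>0

  valid-fits : ∀ rep τ → Valid rep τ → ∀ c → size rep c ≤ k
  valid-fits rep τ valid c = ≤-trans (term≤cl τ (size rep) c) (≤-trans (≤-reflexive (sym (load-size rep τ (τ c)))) (valid (τ c)))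

  -- Weights are rounded down, so any assignment within capacity `k` stays within total weight `G`
  -- per server.
  valid-packs : ∀ rep τ → Valid rep τ → Packs rep τ
  valid-packs rep τ valid s = *-cancelˡ-≤ k (begin
    k * cl τ (λ c → weight (size rep c)) s       ≡⟨ cl-*ˡ τ k (λ c → weight (size rep c)) s ⟨
    cl τ (λ c → k * weight (size rep c)) s       ≤⟨ cl-mono τ (λ c → ≤-trans (≤-reflexive (*-comm k _)) (≤-trans (weight-*k≤ (size rep c)) (≤-reflexive (*-comm _ G)))) s ⟩
    cl τ (λ c → G * size rep c) s                ≡⟨ cl-*ˡ τ G (size rep) s ⟩
    G * cl τ (size rep) s                        ≡⟨ cong (G *_) (load-size rep τ s) ⟨
    G * load (τ ∘ rep) s                         ≤⟨ *-monoʳ-≤ G (valid s) ⟩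
    G * k                                        ≡⟨ *-comm G k ⟩
    k * G                                        ∎)
    where open ≤-Reasoning

  module Merge (rep : Labels) {a b : Fin n} (a≢b : a ≢ b) (a-nonempty : 0 < size rep a) (a≤b : size rep a ≤ size rep b) where

    rep′ : Labels
    rep′ = relabel a b ∘ rep

    size′-a : size rep′ a ≡ 0
    size′-a = cl-relabel-source rep (λ _ → 1) a≢b

    size′-b : size rep′ b ≡ size rep a + size rep b
    size′-b = cl-relabel-target rep (λ _ → 1) a≢b

    size′-other : ∀ {c} → c ≢ a → c ≢ b → size rep′ c ≡ size rep c
    size′-other = cl-relabel-other rep (λ _ → 1) a≢b

    rank-a< : suc (rank rep a) ≤ rank rep′ b
    rank-a< = ≤-trans (log-grows a-nonempty a≤b) (≤-reflexive (cong ⌊log₂_⌋ (sym size′-b)))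

    rank-b≤ : rank rep b ≤ rank rep′ b
    rank-b≤ = ⌊log₂⌋-mono-≤ (≤-trans (m≤n+m (size rep b) (size rep a)) (≤-reflexive (sym size′-b)))

    private
      w w′ : Fin n → ℕ
      w c  = weight (size rep c)
      w′ c = weight (size rep′ c)

      wa≤wb : w a ≤ w b
      wa≤wb = weight-mono a≤b

      w′-b : w a + w b ≤ w′ b
      w′-b = ≤-trans (weight-superadditive (size rep a) (size rep b)) (≤-reflexive (cong weight (sym size′-b)))

      Event : Set
      Event = ¬ (w a ≡ 0 × w′ b ≡ w b)

      w′≤w : ∀ {c} → c ≢ b → w′ c ≤ w c
      w′≤w {c} c≢b with c ≟ a
      ... | yes refl = ≤-trans (≤-reflexive (trans (cong weight size′-a) weight-0)) z≤n
      ... | no c≢a  = ≤-reflexive (cong weight (size′-other c≢a c≢b))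

      Θ-grows : ∀ x → size rep a * rank rep a + B * k * eventPotential (w a) + (size rep b * rank rep b + B * k * eventPotential (w b)) + x
        ≤ (size rep a + size rep b) * rank rep′ b + B * k * eventPotential (w′ b) → sum (Θ rep) + x ≤ sum (Θ rep′)
      Θ-grows x h = sum-mono-pair {a = a} {b = b} x a≢b
        (λ c c≢a c≢b → ≤-reflexive (cong (λ z → z * ⌊log₂ z ⌋ + B * k * eventPotential (weight z)) (sym (size′-other c≢a c≢b))))
        (≤-trans h (≤-trans (≤-reflexive (cong (λ z → z * rank rep′ b + B * k * eventPotential (w′ b)) (sym size′-b))) (m≤n+m (Θ rep′ b) (Θ rep′ a))))

      -- Only the smaller part moves, and each of its vertices gains at least one rank.
      unchanged-weights : ∀ loc → Packs rep loc → w a ≡ 0 → w′ b ≡ w b →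
        Packs rep′ loc × sum (Θ rep) + moves (loc ∘ rep) (loc ∘ rep′) ≤ sum (Θ rep′)
      unchanged-weights loc packs wa≡0 same = packs′ , ≤-trans (+-monoʳ-≤ (sum (Θ rep)) cost) (Θ-grows (size rep a) potential)
        where
        packs′ : Packs rep′ loc
        packs′ s = ≤-trans (cl-mono loc (λ c → pointwise c (c ≟ b)) s) (packs s)
          where
          pointwise : ∀ c → Dec (c ≡ b) → w′ c ≤ w c
          pointwise c (yes refl) = ≤-reflexive same
          pointwise c (no c≢b)   = w′≤w c≢b
        cost : moves (loc ∘ rep) (loc ∘ rep′) ≤ size rep a
        cost = ≤-trans (≤-reflexive (moves-sum (loc ∘ rep) (loc ∘ rep′))) (sum-mono (λ v → pointwise v (rep v ≟ a)))
          where
          pointwise : ∀ v (d : Dec (rep v ≡ a)) → χ (¬? (loc (rep v) ≟ loc (rep′ v))) ≤ χ d * 1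
          pointwise v (yes _) = χ≤1 (¬? (loc (rep v) ≟ loc (rep′ v)))
          pointwise v (no ne) = ≤-reflexive (χ-no (¬? (loc (rep v) ≟ loc (rep′ v))) (λ f → f (cong loc (sym (relabel-miss ne)))))
        potential : size rep a * rank rep a + B * k * eventPotential (w a) + (size rep b * rank rep b + B * k * eventPotential (w b)) + size rep a
          ≤ (size rep a + size rep b) * rank rep′ b + B * k * eventPotential (w′ b)
        potential rewrite wa≡0 | same = begin
          sa * ra + B * k * 0 + (sb * rb + E) + sa  ≡⟨ arith₁ sa ra (B * k) sb rb E ⟩
          sa * suc ra + sb * rb + E                 ≤⟨ +-monoˡ-≤ E (+-mono-≤ (*-monoʳ-≤ sa rank-a<) (*-monoʳ-≤ sb rank-b≤)) ⟩
          sa * r′ + sb * r′ + E                     ≡⟨ cong (_+ E) (*-distribʳ-+ r′ sa sb) ⟨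
          (sa + sb) * r′ + E                        ∎
          where
          open ≤-Reasoning
          sa = size rep a
          sb = size rep b
          ra = rank rep a
          rb = rank rep b
          r′ = rank rep′ b
          E = B * k * eventPotential (w b)
          arith₁ : ∀ sa ra Bk sb rb E → sa * ra + Bk * 0 + (sb * rb + E) + sa ≡ sa * suc ra + sb * rb + E
          arith₁ = solve-∀

      module Rearrangement (loc τ : Config ℓ n) (packs : Packs rep loc) (valid : Valid rep′ τ) (event : Event) where

        open Repack G w′ b loc τ

        loc-packs : ∀ s → cl loc rest s ≤ G
        loc-packs s = ≤-trans (cl-mono loc pointwise s) (packs s)
          where
          pointwise : ∀ c → rest c ≤ w c
          pointwise c = χ-*-≤ (¬? (c ≟ b)) w′≤w

        loc₁ : Config ℓ n
        loc₁ = repacked loc-packs (valid-packs rep′ τ valid)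

        packs₁ : Packs rep′ loc₁
        packs₁ = repacked-packs loc-packs (valid-packs rep′ τ valid)

        changed : Fin n → ℕ
        changed c = χ (¬? (c ≟ b)) * χ (¬? (loc c ≟ loc₁ c))

        cost : moves (loc ∘ rep) (loc₁ ∘ rep′) ≤ B * k
        cost = begin
          moves (loc ∘ rep) (loc₁ ∘ rep′)
            ≡⟨ moves-sum (loc ∘ rep) (loc₁ ∘ rep′) ⟩
          sum (λ v → χ (¬? (loc (rep v) ≟ loc₁ (rep′ v))))
            ≤⟨ sum-mono (λ v → pointwise v (rep′ v ≟ b)) ⟩
          sum (λ v → changed (rep′ v) + χ (rep′ v ≟ b) * 1)
            ≡⟨ ∑-distrib-+ (λ v → changed (rep′ v)) (λ v → χ (rep′ v ≟ b) * 1) ⟩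
          sum (λ v → changed (rep′ v)) + size rep′ b
            ≤⟨ +-monoʳ-≤ (sum (λ v → changed (rep′ v))) (valid-fits rep′ τ valid b) ⟩
          sum (λ v → changed (rep′ v)) + k
            ≡⟨ cong (_+ k) (sum-cl rep′ (λ c _ → changed c)) ⟨
          sum (λ c → cl rep′ (λ _ → changed c) c) + k
            ≤⟨ +-monoˡ-≤ k (sum-mono bounded) ⟩
          sum (λ c → k * changed c) + k
            ≡⟨ cong (_+ k) (*-distribˡ-sum k changed) ⟨
          k * sum changed + k
            ≤⟨ +-monoˡ-≤ k (*-monoʳ-≤ k (repacked-moves loc-packs (valid-packs rep′ τ valid))) ⟩
          k * (blockBound G G * G) + k
            ≡⟨ arith k (blockBound G G * G) ⟩
          B * k ∎
          where
          open ≤-Reasoning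
          arith : ∀ k p → k * p + k ≡ (p + 1) * k
          arith = solve-∀
          bounded : ∀ c → cl rep′ (λ _ → changed c) c ≤ k * changed c
          bounded c = begin
            cl rep′ (λ _ → changed c) c          ≡⟨ sum-cong-≗ (λ v → cong (χ (rep′ v ≟ c) *_) (sym (*-identityʳ (changed c)))) ⟩
            cl rep′ (λ _ → changed c * 1) c      ≡⟨ cl-*ˡ rep′ (changed c) (λ _ → 1) c ⟩
            changed c * size rep′ c              ≤⟨ *-monoʳ-≤ (changed c) (valid-fits rep′ τ valid c) ⟩
            changed c * k                        ≡⟨ *-comm (changed c) k ⟩
            k * changed c                        ∎
          kept : ∀ {c} → relabel a b c ≢ b → relabel a b c ≡ c
          kept {c} ne with c ≟ a
          ... | yes _ = contradiction refl ne
          ... | no _  = refl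
          pointwise : ∀ v (d : Dec (rep′ v ≡ b)) → χ (¬? (loc (rep v) ≟ loc₁ (rep′ v))) ≤ changed (rep′ v) + χ d * 1
          pointwise v (yes _) = ≤-trans (χ≤1 (¬? (loc (rep v) ≟ loc₁ (rep′ v)))) (m≤n+m 1 (changed (rep′ v)))
          pointwise v (no ne) = ≤-trans (≤-reflexive (trans (cong (λ c → χ (¬? (loc c ≟ loc₁ (rep′ v)))) (sym (kept ne)))
            (sym (χ-*-≡ (¬? (rep′ v ≟ b)) _ ne)))) (m≤m+n (changed (rep′ v)) 0)

        potential : sum (Θ rep) + B * k ≤ sum (Θ rep′)
        potential = Θ-grows (B * k) (begin
          sa * ra + Bk * ea + (sb * rb + Bk * eb) + Bk   ≡⟨ arith sa ra sb rb Bk ea eb ⟩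
          sa * ra + sb * rb + Bk * (ea + eb + 1)         ≤⟨ +-mono-≤ (+-mono-≤ (*-monoʳ-≤ sa (≤-trans (n≤1+n ra) rank-a<)) (*-monoʳ-≤ sb rank-b≤))
                                                              (*-monoʳ-≤ Bk (eventPotential-merge wa≤wb w′-b event)) ⟩
          sa * r′ + sb * r′ + Bk * eventPotential (w′ b) ≡⟨ cong (_+ Bk * eventPotential (w′ b)) (*-distribʳ-+ r′ sa sb) ⟨
          (sa + sb) * r′ + Bk * eventPotential (w′ b)    ∎)
          where
          open ≤-Reasoning
          sa = size rep a
          sb = size rep b
          ra = rank rep a
          rb = rank rep b
          r′ = rank rep′ b
          Bk = B * k
          ea = eventPotential (w a)
          eb = eventPotential (w b)
          arith : ∀ sa ra sb rb Bk ea eb → sa * ra + Bk * ea + (sb * rb + Bk * eb) + Bk ≡ sa * ra + sb * rb + Bk * (ea + eb + 1)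
          arith = solve-∀

    repack : ∀ loc τ → Packs rep loc → Valid rep′ τ →
      ∃ λ loc₁ → Packs rep′ loc₁ × sum (Θ rep) + moves (loc ∘ rep) (loc₁ ∘ rep′) ≤ sum (Θ rep′)
    repack loc τ packs valid with (w a ≟ℕ 0) ×-dec (w′ b ≟ℕ w b)
    ... | yes (wa≡0 , same) = loc , unchanged-weights loc packs wa≡0 same
    ... | no event = loc₁ , packs₁ , ≤-trans (+-monoʳ-≤ (sum (Θ rep)) cost) potential
      where open Rearrangement loc τ packs valid event

    Φ : Config ℓ n → ℕ
    Φ = overload m (suc m * k)

    abstract
      -- The factor `2 * m` charges a repacking move twice: for itself, and for the overload it may
      -- create, which pays for evictions.
      repack-and-evict : ∀ loc τ → Packs rep loc → Valid rep′ τ →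
        ∃ λ loc′ → Packs rep′ loc′ × (∀ s → m * load (loc′ ∘ rep′) s ≤ suc (suc m) * k) ×
          m * moves (loc ∘ rep) (loc′ ∘ rep′) + Φ (loc′ ∘ rep′) + 2 * m * sum (Θ rep) ≤ Φ (loc ∘ rep) + 2 * m * sum (Θ rep′)
      repack-and-evict loc τ packs valid with repack loc τ packs valid
      ... | loc₁ , packs₁ , paid with Eviction.evict ℓ k m m>0 rep′ _ loc₁ packs₁ ≤-refl
      ...   | loc₂ , packs₂ , cap , cost = loc₂ , packs₂ , cap , (begin
        m * moves σ σ₂ + Φ σ₂ + 2 * m * T        ≤⟨ +-monoˡ-≤ (2 * m * T) (+-monoˡ-≤ (Φ σ₂) (*-monoʳ-≤ m (moves-triangle σ σ₁ σ₂))) ⟩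
        m * (x + y) + Φ σ₂ + 2 * m * T           ≡⟨ arith₁ m x y (Φ σ₂) T ⟩
        m * y + Φ σ₂ + (m * x + 2 * m * T)       ≤⟨ +-monoˡ-≤ (m * x + 2 * m * T) (≤-trans cost (overload-moves m (suc m * k) σ σ₁)) ⟩
        Φ σ + m * x + (m * x + 2 * m * T)        ≡⟨ arith₂ m x (Φ σ) T ⟩
        Φ σ + 2 * m * (T + x)                    ≤⟨ +-monoʳ-≤ (Φ σ) (*-monoʳ-≤ (2 * m) paid) ⟩
        Φ σ + 2 * m * sum (Θ rep′)               ∎)
        where
        open ≤-Reasoning
        σ σ₁ σ₂ : Config ℓ n
        σ  = loc ∘ rep
        σ₁ = loc₁ ∘ rep′
        σ₂ = loc₂ ∘ rep′
        x y T : ℕ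
        x  = moves σ σ₁
        y  = moves σ₁ σ₂
        T  = sum (Θ rep)
        arith₁ : ∀ m x y p T → m * (x + y) + p + 2 * m * T ≡ m * y + p + (m * x + 2 * m * T)
        arith₁ = solve-∀
        arith₂ : ∀ m x p T → p + m * x + (m * x + 2 * m * T) ≡ p + 2 * m * (T + x)
        arith₂ = solve-∀

-- Majority phase

module Phases (ℓ k m : ℕ) .{{_ : NonZero k}} (m>0 : 0 < m) (init : Config ℓ (ℓ * k)) (balanced : Balanced k init) where

  open Packing ℓ k m m>0 public

  private
    n = ℓ * k

  misplaced : Labels → Fin ℓ → Fin n → ℕ
  misplaced rep s = cl rep (λ v → χ (¬? (init v ≟ s)))

  D : Labels → Config ℓ n → ℕ
  D rep τ = moves init (τ ∘ rep)

  D-sum : ∀ rep τ → D rep τ ≡ sum (λ c → misplaced rep (τ c) c)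
  D-sum rep τ = trans (moves-sum init (τ ∘ rep)) (sym (sum-cl rep (λ c v → χ (¬? (init v ≟ τ c)))))

  misplaced≤size : ∀ rep s c → misplaced rep s c ≤ size rep c
  misplaced≤size rep s c = cl-mono rep (λ v → χ≤1 (¬? (init v ≟ s))) c

  size≤misplaced+misplaced : ∀ rep {s t} → s ≢ t → ∀ c → size rep c ≤ misplaced rep s c + misplaced rep t c
  size≤misplaced+misplaced rep {s} {t} s≢t c = ≤-trans (cl-mono rep pointwise c)
    (≤-reflexive (cl-+ rep (λ v → χ (¬? (init v ≟ s))) (λ v → χ (¬? (init v ≟ t))) c))
    where
    pointwise : ∀ v → 1 ≤ χ (¬? (init v ≟ s)) + χ (¬? (init v ≟ t))
    pointwise v with init v ≟ s
    ... | yes refl = ≤-reflexive (sym (χ-yes (¬? (init v ≟ t)) s≢t))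
    ... | no _     = s≤s z≤n

  -- Since `2 ^ rank` exceeds half of the size, every server other than `loc c` misplaces more than
  -- a quarter of a nonempty component. Using the rank instead of the size lets a component keep its
  -- server until its rank grows.
  Majority : Labels → Config ℓ n → Set
  Majority rep loc = ∀ c → 0 < size rep c → ∀ s → s ≢ loc c → 2 ^ rank rep c ≤ 2 * misplaced rep s c

  -- The second term covers the move to the current server. When the component moves again, the
  -- growth of the first term with the rank absorbs it.
  Ψ : Labels → Config ℓ n → Config ℓ n → Fin n → ℕ
  Ψ rep loc τ c = 16 * (rank rep c * misplaced rep (τ c) c) + 4 * misplaced rep (loc c) c

  -- τ ranges over arbitrary assignments of the components, so that the final offline assignment can be plugged in.
  record Phase₁ (rep : Labels) (loc : Config ℓ n) (Z : ℕ) : Set where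
    field
      majority : Majority rep loc
      paid     : ∀ τ → Z ≤ sum (Ψ rep loc τ)

  size≤4misplaced : ∀ {rep loc} → Majority rep loc → ∀ c s → s ≢ loc c → size rep c ≤ 4 * misplaced rep s c
  size≤4misplaced {rep} maj c s s≢ with size rep c ≟ℕ 0
  ... | yes e = ≤-trans (≤-reflexive e) z≤n
  ... | no ne = begin
    size rep c                            ≤⟨ <⇒≤ (x<2^[1+⌊log₂x⌋] (size rep c)) ⟩
    2 * 2 ^ rank rep c                    ≤⟨ *-monoʳ-≤ 2 (maj c (n≢0⇒n>0 ne) s s≢) ⟩
    2 * (2 * misplaced rep s c)           ≡⟨ *-assoc 2 2 (misplaced rep s c) ⟨
    4 * misplaced rep s c                 ∎
    where open ≤-Reasoning

  misplaced≤4misplaced : ∀ {rep loc} → Majority rep loc → ∀ c s → misplaced rep (loc c) c ≤ 4 * misplaced rep s c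
  misplaced≤4misplaced {rep} {loc} maj c s with s ≟ loc c
  ... | yes refl = m≤n*m (misplaced rep s c) 4
  ... | no s≢    = ≤-trans (misplaced≤size rep (loc c) c) (size≤4misplaced {rep} {loc} maj c s s≢)

  D-majority : ∀ {rep loc} → Majority rep loc → ∀ τ → D rep loc ≤ 4 * D rep τ
  D-majority {rep} {loc} maj τ = begin
    D rep loc                                   ≡⟨ D-sum rep loc ⟩
    sum (λ c → misplaced rep (loc c) c)         ≤⟨ sum-mono (λ c → misplaced≤4misplaced {rep} {loc} maj c (τ c)) ⟩
    sum (λ c → 4 * misplaced rep (τ c) c)       ≡⟨ *-distribˡ-sum 4 (λ c → misplaced rep (τ c) c) ⟨
    4 * sum (λ c → misplaced rep (τ c) c)       ≡⟨ cong (4 *_) (D-sum rep τ) ⟨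
    4 * D rep τ                                 ∎
    where open ≤-Reasoning

  -- Initially each server has load `k`, and at most `D rep loc ≤ 4 * D rep τ ≤ 2k/m` vertices are
  -- added.
  majority-cap : ∀ {rep loc} → Majority rep loc → ∀ τ → 2 * m * D rep τ ≤ k → ∀ s → m * load (loc ∘ rep) s ≤ suc (suc m) * k
  majority-cap {rep} {loc} maj τ near s = begin
    m * load (loc ∘ rep) s            ≤⟨ *-monoʳ-≤ m (≤-trans (load-moves init (loc ∘ rep) s) (+-mono-≤ (≤-reflexive (balanced s)) (cl-moves≤ init (loc ∘ rep) s))) ⟩
    m * (k + D rep loc)               ≤⟨ *-monoʳ-≤ m (+-monoʳ-≤ k (D-majority {rep} {loc} maj τ)) ⟩
    m * (k + 4 * D rep τ)             ≡⟨ arith₁ m k (D rep τ) ⟩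
    m * k + 2 * (2 * m * D rep τ)     ≤⟨ +-monoʳ-≤ (m * k) (*-monoʳ-≤ 2 near) ⟩
    m * k + 2 * k                     ≡⟨ arith₂ m k ⟩
    suc (suc m) * k                   ∎
    where
    open ≤-Reasoning
    arith₁ : ∀ m k d → m * (k + 4 * d) ≡ m * k + 2 * (2 * m * d)
    arith₁ = solve-∀
    arith₂ : ∀ m k → m * k + 2 * k ≡ suc (suc m) * k
    arith₂ = solve-∀

  sum-Ψ≤ : ∀ {rep loc} R → (∀ c → rank rep c ≤ R) → ∀ τ → sum (Ψ rep loc τ) ≤ 16 * (R * D rep τ) + 4 * D rep loc
  sum-Ψ≤ {rep} {loc} R rank≤ τ = begin
    sum (Ψ rep loc τ)
      ≤⟨ sum-mono (λ c → +-monoˡ-≤ (4 * misplaced rep (loc c) c) (*-monoʳ-≤ 16 (*-monoˡ-≤ (misplaced rep (τ c) c) (rank≤ c)))) ⟩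
    sum (λ c → 16 * (R * misplaced rep (τ c) c) + 4 * misplaced rep (loc c) c)
      ≡⟨ ∑-distrib-+ (λ c → 16 * (R * misplaced rep (τ c) c)) (λ c → 4 * misplaced rep (loc c) c) ⟩
    sum (λ c → 16 * (R * misplaced rep (τ c) c)) + sum (λ c → 4 * misplaced rep (loc c) c)
      ≡⟨ cong₂ _+_ (*-distribˡ-sum 16 (λ c → R * misplaced rep (τ c) c)) (*-distribˡ-sum 4 (λ c → misplaced rep (loc c) c)) ⟨
    16 * sum (λ c → R * misplaced rep (τ c) c) + 4 * sum (λ c → misplaced rep (loc c) c)
      ≡⟨ cong₂ (λ x y → 16 * x + 4 * y) (sym (*-distribˡ-sum R (λ c → misplaced rep (τ c) c))) (sym (D-sum rep loc)) ⟩
    16 * (R * sum (λ c → misplaced rep (τ c) c)) + 4 * D rep loc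
      ≡⟨ cong (λ x → 16 * (R * x) + 4 * D rep loc) (D-sum rep τ) ⟨
    16 * (R * D rep τ) + 4 * D rep loc ∎
    where open ≤-Reasoning

  module Merge₁ (rep : Labels) {a b : Fin n} (a≢b : a ≢ b) (a-nonempty : 0 < size rep a) (a≤b : size rep a ≤ size rep b)
    (loc : Config ℓ n) (maj : Majority rep loc) where

    open Merge rep a≢b a-nonempty a≤b

    private
      misplaced′-b : ∀ s → misplaced rep′ s b ≡ misplaced rep s a + misplaced rep s b
      misplaced′-b s = cl-relabel-target rep (λ v → χ (¬? (init v ≟ s))) a≢b

      misplaced′-other : ∀ s {c} → c ≢ a → c ≢ b → misplaced rep′ s c ≡ misplaced rep s c
      misplaced′-other s = cl-relabel-other rep (λ v → χ (¬? (init v ≟ s))) a≢b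

      r′ : ℕ
      r′ = rank rep′ b

    -- A server that misplaces fewer than `2 ^ r′ / 2` vertices is unique, because any two servers
    -- together misplace the whole component; it becomes the new location. If there is none, `loc b`
    -- is kept.
    choice : ∃ λ s → (∀ t → t ≢ s → 2 ^ r′ ≤ 2 * misplaced rep′ t b) × (loc b ≢ s → suc (rank rep b) ≤ r′)
    choice with any? (λ s → 2 * misplaced rep′ s b <? 2 ^ r′)
    ... | no none = loc b , (λ t _ → ≮⇒≥ (λ dom → none (t , dom))) , λ ne → contradiction refl ne
    ... | yes (s , dom) = s , others , moved
      where
      others : ∀ t → t ≢ s → 2 ^ r′ ≤ 2 * misplaced rep′ t b
      others t t≢s = +-cancelʳ-≤ (2 ^ r′) _ _ (begin
        2 ^ r′ + 2 ^ r′                                          ≡⟨ cong (2 ^ r′ +_) (+-identityʳ (2 ^ r′)) ⟨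
        2 * 2 ^ r′                                               ≤⟨ *-monoʳ-≤ 2 (2^⌊log₂x⌋≤x (size rep′ b) (≤-trans a-nonempty (≤-trans (m≤m+n _ _) (≤-reflexive (sym size′-b))))) ⟩
        2 * size rep′ b                                          ≤⟨ *-monoʳ-≤ 2 (size≤misplaced+misplaced rep′ t≢s b) ⟩
        2 * (misplaced rep′ t b + misplaced rep′ s b)            ≡⟨ *-distribˡ-+ 2 (misplaced rep′ t b) (misplaced rep′ s b) ⟩
        2 * misplaced rep′ t b + 2 * misplaced rep′ s b          ≤⟨ +-monoʳ-≤ (2 * misplaced rep′ t b) (<⇒≤ dom) ⟩
        2 * misplaced rep′ t b + 2 ^ r′                          ∎)
        where open ≤-Reasoning
      -- With an unchanged rank, the old majority condition for `b` would already bound the vertices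
      -- misplaced at `s` from below.
      moved : loc b ≢ s → suc (rank rep b) ≤ r′
      moved ne = ≤∧≢⇒< rank-b≤ λ same → <⇒≱ dom (begin
        2 ^ r′                         ≡⟨ cong (2 ^_) same ⟨
        2 ^ rank rep b                 ≤⟨ maj b (≤-trans a-nonempty a≤b) s (ne ∘ sym) ⟩
        2 * misplaced rep s b          ≤⟨ *-monoʳ-≤ 2 (m≤n+m (misplaced rep s b) (misplaced rep s a)) ⟩
        2 * (misplaced rep s a + misplaced rep s b) ≡⟨ cong (2 *_) (misplaced′-b s) ⟨
        2 * misplaced rep′ s b         ∎)
        where open ≤-Reasoning

    module Place (s₀ : Fin ℓ) (dominates : ∀ t → t ≢ s₀ → 2 ^ r′ ≤ 2 * misplaced rep′ t b) (gains : loc b ≢ s₀ → suc (rank rep b) ≤ r′) where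

      loc′ : Config ℓ n
      loc′ = relocate loc b s₀

      majority′ : Majority rep′ loc′
      majority′ c pos s s≢ = go (c ≟ a) (c ≟ b)
        where
        go : Dec (c ≡ a) → Dec (c ≡ b) → 2 ^ rank rep′ c ≤ 2 * misplaced rep′ s c
        go (yes refl) _ = contradiction pos (≤⇒≯ (≤-reflexive size′-a))
        go (no _) (yes refl) = dominates s (λ e → s≢ (trans e (sym (relocate-hit loc b s₀))))
        go (no c≢a) (no c≢b) = subst₂ (λ x y → 2 ^ ⌊log₂ x ⌋ ≤ 2 * y) (sym (size′-other c≢a c≢b)) (sym (misplaced′-other s c≢a c≢b))
          (maj c (≤-trans pos (≤-reflexive (size′-other c≢a c≢b))) s (λ e → s≢ (trans e (sym (relocate-miss loc b s₀ c≢b)))))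

      -- A part that moves gains a rank; the gain pays for its old misplaced vertices,
      -- and the misplaced vertices at the new server pay for the move.
      part : ∀ c → rank rep c ≤ r′ → (loc c ≢ s₀ → suc (rank rep c) ≤ r′) → ∀ t →
        16 * (rank rep c * misplaced rep t c) + 4 * misplaced rep (loc c) c + χ (¬? (loc c ≟ s₀)) * size rep c
          ≤ 16 * (r′ * misplaced rep t c) + 4 * misplaced rep s₀ c
      part c r≤ r< t with loc c ≟ s₀
      ... | yes refl = ≤-trans (≤-reflexive (+-identityʳ _)) (+-monoˡ-≤ _ (*-monoʳ-≤ 16 (*-monoˡ-≤ (misplaced rep t c) r≤)))
      ... | no ne = begin
        16 * (r * x) + 4 * y + (z + 0)            ≤⟨ +-mono-≤ (+-monoʳ-≤ (16 * (r * x)) (*-monoʳ-≤ 4 (misplaced≤4misplaced {rep} {loc} maj c t)))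
                                                       (≤-trans (≤-reflexive (+-identityʳ z)) (size≤4misplaced {rep} {loc} maj c s₀ (ne ∘ sym))) ⟩
        16 * (r * x) + 4 * (4 * x) + 4 * u        ≡⟨ arith r x u ⟩
        16 * (suc r * x) + 4 * u                  ≤⟨ +-monoˡ-≤ (4 * u) (*-monoʳ-≤ 16 (*-monoˡ-≤ x (r< ne))) ⟩
        16 * (r′ * x) + 4 * u                     ∎
        where
        open ≤-Reasoning
        r = rank rep c
        x = misplaced rep t c
        y = misplaced rep (loc c) c
        z = size rep c
        u = misplaced rep s₀ c
        arith : ∀ r x u → 16 * (r * x) + 4 * (4 * x) + 4 * u ≡ 16 * (suc r * x) + 4 * u
        arith = solve-∀

      cost : Fin n → ℕ
      cost c = χ (¬? (loc c ≟ loc′ (relabel a b c))) * size rep c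

      moves-cost : moves (loc ∘ rep) (loc′ ∘ rep′) ≡ sum cost
      moves-cost = trans (moves-sum (loc ∘ rep) (loc′ ∘ rep′))
        (trans (sym (sum-cl rep (λ c _ → moved c)))
          (sum-cong-≗ (λ c → trans (sum-cong-≗ (λ v → cong (χ (rep v ≟ c) *_) (sym (*-identityʳ (moved c)))))
            (cl-*ˡ rep (moved c) (λ _ → 1) c))))
        where
        moved : Fin n → ℕ
        moved c = χ (¬? (loc c ≟ loc′ (relabel a b c)))

      paid′ : ∀ {Z} → (∀ τ → Z ≤ sum (Ψ rep loc τ)) → ∀ τ → Z + moves (loc ∘ rep) (loc′ ∘ rep′) ≤ sum (Ψ rep′ loc′ τ)
      paid′ {Z} paid τ = begin
        Z + moves (loc ∘ rep) (loc′ ∘ rep′)        ≤⟨ +-mono-≤ (paid τ₀) (≤-reflexive moves-cost) ⟩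
        sum (Ψ rep loc τ₀) + sum cost              ≡⟨ ∑-distrib-+ (Ψ rep loc τ₀) cost ⟨
        sum f                                      ≡⟨ +-identityʳ (sum f) ⟨
        sum f + 0                                  ≤⟨ sum-mono-pair {a = a} {b = b} 0 a≢b other pair ⟩
        sum (Ψ rep′ loc′ τ)                        ∎
        where
        open ≤-Reasoning
        -- The old bound is applied to the assignment that puts both parts where `τ` puts the merged
        -- component.
        τ₀ : Config ℓ n
        τ₀ = τ ∘ relabel a b
        f : Fin n → ℕ
        f c = Ψ rep loc τ₀ c + cost c
        other : ∀ c → c ≢ a → c ≢ b → f c ≤ Ψ rep′ loc′ τ c
        other c c≢a c≢b rewrite relabel-miss {a = a} {b = b} c≢a | relocate-miss loc b s₀ c≢b
          | size′-other c≢a c≢b | misplaced′-other (τ c) c≢a c≢b | misplaced′-other (loc c) c≢a c≢b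
          | χ-no (¬? (loc c ≟ loc c)) (λ g → g refl) = ≤-reflexive (+-identityʳ _)
        pair : f a + f b + 0 ≤ Ψ rep′ loc′ τ a + Ψ rep′ loc′ τ b
        pair = ≤-trans (≤-reflexive (+-identityʳ (f a + f b))) (≤-trans merged (m≤n+m (Ψ rep′ loc′ τ b) (Ψ rep′ loc′ τ a)))
          where
          t = τ b
          merged : f a + f b ≤ Ψ rep′ loc′ τ b
          merged rewrite relabel-hit a b | relabel-miss {a = a} {b = b} (a≢b ∘ sym) | relocate-hit loc b s₀ | misplaced′-b t | misplaced′-b s₀ = begin
            _ ≤⟨ +-mono-≤ (part a (≤-trans (n≤1+n _) rank-a<) (λ _ → rank-a<) t) (part b rank-b≤ gains t) ⟩
            (16 * (r′ * misplaced rep t a) + 4 * misplaced rep s₀ a) + (16 * (r′ * misplaced rep t b) + 4 * misplaced rep s₀ b)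
              ≡⟨ arith r′ (misplaced rep t a) (misplaced rep t b) (misplaced rep s₀ a) (misplaced rep s₀ b) ⟩
            16 * (r′ * (misplaced rep t a + misplaced rep t b)) + 4 * (misplaced rep s₀ a + misplaced rep s₀ b) ∎
            where
            arith : ∀ r x y u v → (16 * (r * x) + 4 * u) + (16 * (r * y) + 4 * v) ≡ 16 * (r * (x + y)) + 4 * (u + v)
            arith = solve-∀

    abstract
      phase₁-step : ∀ {Z} → (∀ τ → Z ≤ sum (Ψ rep loc τ)) →
        ∃ λ loc′ → Phase₁ rep′ loc′ (Z + moves (loc ∘ rep) (loc′ ∘ rep′))
      phase₁-step paid with choice
      ... | s₀ , dominates , gains = loc′ , record { majority = majority′ ; paid = paid′ paid }
        where open Place s₀ dominates gains

-- The online algorithm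

-- The summand `32` covers the majority phase. In the other, `4 * m` combines the factor 2 of the
-- cost bound with `k ≤ 2 * m * D`, and `22` collects `16 + 1` logarithmic terms and the constant
-- `5`.
ratio : ℕ → ℕ
ratio m = 32 + 4 * m * (22 + 2 * (blockBound (m * m) (m * m) * (m * m) + 1) * (m * m))

module Algorithm (ℓ k m : ℕ) .{{_ : NonZero k}} (m>0 : 0 < m) (init : Config ℓ (ℓ * k)) (balanced : Balanced k init) where

  open Phases ℓ k m m>0 init balanced public

  private
    n = ℓ * k

  R : ℕ
  R = ⌊log₂ k ⌋

  -- Covers the whole majority phase, `16 R n + 4 n`, and the at most `n` moves of the switch to
  -- packing.
  K₀ : ℕ
  K₀ = (16 * R + 5) * n

  Φ : Config ℓ n → ℕ
  Φ = overload m (suc m * k)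

  -- The term `Φ` in `paid` reserves the cost of future evictions. The lower bound `far` is what
  -- this cost is later compared with.
  record Phase₂ (rep : Labels) (loc : Config ℓ n) (Z : ℕ) : Set where
    field
      packs : Packs rep loc
      paid  : m * Z + Φ (loc ∘ rep) ≤ 2 * m * (K₀ + sum (Θ rep))
      far   : ∀ τ → k ≤ 2 * m * D rep τ

  record Invariant (rep : Labels) (loc : Config ℓ n) (Z : ℕ) : Set where
    field
      idempotent : ∀ v → rep (rep v) ≡ rep v
      fits       : ∀ c → size rep c ≤ k
      cap        : ∀ s → m * load (loc ∘ rep) s ≤ suc (suc m) * k
      phase      : Phase₁ rep loc Z ⊎ Phase₂ rep loc Z

  abstract
    -- Decided by exhaustive search from `init` and the current components only, so the phase change
    -- is deterministic and online.
    near? : ∀ rep → Dec (∃ λ τ → 2 * m * D rep τ ≤ k)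
    near? rep = anyFunction? (λ eq → ≤-trans (≤-reflexive (cong (2 * m *_) (moves-cong (λ _ → refl) (λ v → sym (eq (rep v)))))))
      (λ τ → 2 * m * D rep τ ≤? k)

    valid? : ∀ rep → Dec (∃ (Valid rep))
    valid? rep = anyFunction? (λ eq valid s → ≤-trans (≤-reflexive (load-cong (λ v → sym (eq (rep v))) s)) (valid s))
      (λ τ → all? (λ s → load (τ ∘ rep) s ≤? k))

  rank≤R : ∀ rep → (∀ c → size rep c ≤ k) → ∀ c → rank rep c ≤ R
  rank≤R rep fits c = ⌊log₂⌋-mono-≤ (fits c)

  -- The configuration is replaced by a valid assignment, which has no overload; even moving every
  -- vertex is affordable here.
  switch : ∀ {rep rep′ loc Z} → (∀ c → size rep c ≤ k) → Phase₁ rep loc Z → ∀ τ → Valid rep′ τ →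
    ¬ (∃ λ τ → 2 * m * D rep′ τ ≤ k) → Phase₂ rep′ τ (Z + moves (loc ∘ rep) (τ ∘ rep′))
  switch {rep} {rep′} {loc} {Z} fits phase τ valid ¬near = record
    { packs = valid-packs rep′ τ valid
    ; paid  = begin
        m * (Z + x) + Φ (τ ∘ rep′)                ≡⟨ cong (m * (Z + x) +_) Φ≡0 ⟩
        m * (Z + x) + 0                           ≡⟨ +-identityʳ _ ⟩
        m * (Z + x)                               ≤⟨ *-monoʳ-≤ m (+-mono-≤ Z≤ (moves-≤ (loc ∘ rep) (τ ∘ rep′))) ⟩
        m * (16 * (R * n) + 4 * n + n)            ≡⟨ cong (m *_) (arith R n) ⟩
        m * K₀                                    ≤⟨ *-mono-≤ (m≤n*m m 2) (m≤m+n K₀ (sum (Θ rep′))) ⟩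
        2 * m * (K₀ + sum (Θ rep′))               ∎
    ; far   = λ τ → <⇒≤ (≰⇒> (λ le → ¬near (τ , le)))
    }
    where
    open ≤-Reasoning
    x = moves (loc ∘ rep) (τ ∘ rep′)
    arith : ∀ R n → 16 * (R * n) + 4 * n + n ≡ (16 * R + 5) * n
    arith = solve-∀
    -- The bound `paid` holds for all assignments; it is used for `loc` itself, with the trivial
    -- estimate `D ≤ n`.
    Z≤ : Z ≤ 16 * (R * n) + 4 * n
    Z≤ = ≤-trans (Phase₁.paid phase loc) (≤-trans (sum-Ψ≤ {rep} {loc} R (rank≤R rep fits) loc)
      (+-mono-≤ (*-monoʳ-≤ 16 (*-monoʳ-≤ R (moves-≤ init (loc ∘ rep)))) (*-monoʳ-≤ 4 (moves-≤ init (loc ∘ rep)))))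
    Φ≡0 : Φ (τ ∘ rep′) ≡ 0
    Φ≡0 = sum-zero (λ s → m≤n⇒m∸n≡0 (*-mono-≤ (n≤1+n m) (valid s)))

  module Join {rep : Labels} {loc : Config ℓ n} {Z : ℕ} (inv : Invariant rep loc Z) {a b : Fin n} (a≢b : a ≢ b)
    (rep-a : rep a ≡ a) (rep-b : rep b ≡ b) (a≤b : size rep a ≤ size rep b) where

    open Invariant inv

    a-nonempty : 0 < size rep a
    a-nonempty = ≤-trans (term≤cl rep (λ _ → 1) a) (≤-reflexive (cong (size rep) rep-a))

    open Merge rep a≢b a-nonempty a≤b hiding (Φ)

    idempotent′ : ∀ v → rep′ (rep′ v) ≡ rep′ v
    idempotent′ v with rep v ≟ a
    ... | yes _   = trans (cong (relabel a b) rep-b) (relabel-miss (a≢b ∘ sym))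
    ... | no r≢a = trans (cong (relabel a b) (idempotent v)) (relabel-miss r≢a)

    Next : Set
    Next = ∃ λ loc′ → Invariant rep′ loc′ (Z + moves (loc ∘ rep) (loc′ ∘ rep′))

    stay : ∀ τ → Valid rep′ τ → ∀ τ₀ → 2 * m * D rep′ τ₀ ≤ k →
      (∃ λ loc′ → Phase₁ rep′ loc′ (Z + moves (loc ∘ rep) (loc′ ∘ rep′))) → Next
    stay τ valid τ₀ near (loc′ , phase₁′) = loc′ , record
      { idempotent = idempotent′
      ; fits       = valid-fits rep′ τ valid
      ; cap        = majority-cap {rep′} {loc′} (Phase₁.majority phase₁′) τ₀ near
      ; phase      = inj₁ phase₁′
      }

    leave : ∀ τ → Valid rep′ τ → Phase₁ rep loc Z → ¬ (∃ λ τ → 2 * m * D rep′ τ ≤ k) → Next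
    leave τ valid phase₁ ¬near = τ , record
      { idempotent = idempotent′
      ; fits       = valid-fits rep′ τ valid
      ; cap        = λ s → *-mono-≤ (≤-trans (n≤1+n m) (n≤1+n (suc m))) (valid s)
      ; phase      = inj₂ (switch {rep} {rep′} {loc} fits phase₁ τ valid ¬near)
      }

    continue : ∀ τ → Valid rep′ τ → Phase₂ rep loc Z →
      (∃ λ loc′ → Packs rep′ loc′ × (∀ s → m * load (loc′ ∘ rep′) s ≤ suc (suc m) * k) ×
        m * moves (loc ∘ rep) (loc′ ∘ rep′) + Φ (loc′ ∘ rep′) + 2 * m * sum (Θ rep) ≤ Φ (loc ∘ rep) + 2 * m * sum (Θ rep′)) → Next
    continue τ valid phase₂ (loc′ , packs′ , cap′ , cost) = loc′ , record
      { idempotent = idempotent′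
      ; fits       = valid-fits rep′ τ valid
      ; cap        = cap′
      ; phase      = inj₂ (record
          { packs = packs′
          ; paid  = +-cancelʳ-≤ (2 * m * T) _ _ (begin
              m * (Z + x) + Φ (loc′ ∘ rep′) + 2 * m * T             ≡⟨ arith₁ m Z x (Φ (loc′ ∘ rep′)) T ⟩
              m * Z + (m * x + Φ (loc′ ∘ rep′) + 2 * m * T)         ≤⟨ +-monoʳ-≤ (m * Z) cost ⟩
              m * Z + (Φ (loc ∘ rep) + 2 * m * T′)                  ≡⟨ +-assoc (m * Z) (Φ (loc ∘ rep)) (2 * m * T′) ⟨
              m * Z + Φ (loc ∘ rep) + 2 * m * T′                    ≤⟨ +-monoˡ-≤ (2 * m * T′) (Phase₂.paid phase₂) ⟩
              2 * m * (K₀ + T) + 2 * m * T′                         ≡⟨ arith₂ m K₀ T T′ ⟩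
              2 * m * (K₀ + T′) + 2 * m * T                         ∎)
          -- An assignment of the merged components is also an assignment of the old ones, so the
          -- lower bound persists.
          ; far   = λ τ → Phase₂.far phase₂ (τ ∘ relabel a b)
          })
      }
      where
      open ≤-Reasoning
      x = moves (loc ∘ rep) (loc′ ∘ rep′)
      T = sum (Θ rep)
      T′ = sum (Θ rep′)
      arith₁ : ∀ m Z x p T → m * (Z + x) + p + 2 * m * T ≡ m * Z + (m * x + p + 2 * m * T)
      arith₁ = solve-∀
      arith₂ : ∀ m K T T′ → 2 * m * (K + T) + 2 * m * T′ ≡ 2 * m * (K + T′) + 2 * m * T
      arith₂ = solve-∀

    by-phase : ∀ τ → Valid rep′ τ → Phase₁ rep loc Z ⊎ Phase₂ rep loc Z → Dec (∃ λ τ → 2 * m * D rep′ τ ≤ k) → Next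
    by-phase τ valid (inj₁ phase₁) (yes (τ₀ , near)) = stay τ valid τ₀ near
      (Merge₁.phase₁-step rep a≢b a-nonempty a≤b loc (Phase₁.majority phase₁) (Phase₁.paid phase₁))
    by-phase τ valid (inj₁ phase₁) (no ¬near) = leave τ valid phase₁ ¬near
    by-phase τ valid (inj₂ phase₂) _ = continue τ valid phase₂ (repack-and-evict loc τ (Phase₂.packs phase₂) valid)

    abstract
      join : ∀ τ → Valid rep′ τ → Next
      join τ valid = by-phase τ valid phase (near? rep′)

  -- Runs of the algorithm

  data State : Set where
    alive : (rep : Labels) (loc : Config ℓ n) (Z : ℕ) → Invariant rep loc Z → State
    dead  : State

  conf : State → Config ℓ n
  conf (alive rep loc _ _) = loc ∘ rep
  conf dead                = init

  size-id : ∀ c → size (λ v → v) c ≡ 1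
  size-id c = sum-χ-*′ c (λ _ → 1)

  start : State
  start = alive (λ v → v) init 0 record
    { idempotent = λ _ → refl
    ; fits       = λ c → ≤-trans (≤-reflexive (size-id c)) (n≢0⇒n>0 (≢-nonZero⁻¹ k))
    ; cap        = λ s → *-mono-≤ (≤-trans (n≤1+n m) (n≤1+n (suc m))) (≤-reflexive (balanced s))
    ; phase      = inj₁ (record { majority = majority ; paid = λ _ → z≤n })
    }
    where
    majority : Majority (λ v → v) init
    majority c _ s s≢ rewrite size-id c | sum-χ-*′ c (λ v → χ (¬? (init v ≟ s))) | χ-yes (¬? (init c ≟ s)) (s≢ ∘ sym) = s≤s z≤n

  join-state : ∀ {rep loc Z} → Invariant rep loc Z → ∀ {a b} → a ≢ b → rep a ≡ a → rep b ≡ b → size rep a ≤ size rep b →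
    Dec (∃ (Valid (relabel a b ∘ rep))) → State
  join-state {rep} {loc} {Z} inv {a} {b} a≢b rep-a rep-b a≤b (yes (τ , valid)) =
    let (loc′ , inv′) = Join.join inv a≢b rep-a rep-b a≤b τ valid
    in alive (relabel a b ∘ rep) loc′ (Z + moves (loc ∘ rep) (loc′ ∘ relabel a b ∘ rep)) inv′
  -- A default for components that no assignment of capacity `k` can hold; valid sequences exclude
  -- it.
  join-state inv a≢b rep-a rep-b a≤b (no _) = dead

  advance : State → Edge n → State
  advance dead _ = dead
  advance st@(alive rep loc Z inv) (u , v) with rep u ≟ rep v
  ... | yes _ = st
  ... | no ne with ≤-total (size rep (rep u)) (size rep (rep v))
  ...   | inj₁ u≤v = join-state inv ne (Invariant.idempotent inv u) (Invariant.idempotent inv v) u≤v (valid? (relabel (rep u) (rep v) ∘ rep))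
  ...   | inj₂ v≤u = join-state inv (ne ∘ sym) (Invariant.idempotent inv v) (Invariant.idempotent inv u) v≤u (valid? (relabel (rep v) (rep u) ∘ rep))

  run : List (Edge n) → State
  run = foldl advance start

  output : List (Edge n) → Config ℓ n
  output es = conf (run es)

  -- Correctness of the component labels

  Respects : ∀ {A : Set} → List (Edge n) → (Fin n → A) → Set
  Respects es f = ∀ {x y} → (x , y) ∈ es → f x ≡ f y

  -- Connectedness is expressed through assignments: whatever is constant along the edges is
  -- constant on classes. In this form it applies directly to offline configurations.
  record Components (es : List (Edge n)) (rep : Labels) : Set where
    field
      sound    : Respects es rep
      complete : ∀ (σ : Config ℓ n) → Respects es σ → ∀ {x y} → rep x ≡ rep y → σ x ≡ σ y

  -- Identifies the recorded `Z` with the true number of moves. Excluding `dead` makes tracking also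
  -- a proof that the run stays alive.
  Tracks : List (Edge n) → ℕ → State → Set
  Tracks es Z₀ (alive rep loc Z _) = Components es rep × Z ≡ Z₀
  Tracks es Z₀ dead                = ⊥

  respects-init : ∀ {A : Set} {es e} {f : Fin n → A} → Respects (es ∷ʳ e) f → Respects es f
  respects-init resp xy∈es = resp (∈-++⁺ˡ xy∈es)

  respects-last : ∀ {A : Set} es {u v} {f : Fin n → A} → Respects (es ∷ʳ (u , v)) f → f u ≡ f v
  respects-last es resp = resp (∈-++⁺ʳ es (here refl))

  respects-snoc : ∀ {A : Set} {es u v} {f : Fin n → A} → Respects es f → f u ≡ f v → Respects (es ∷ʳ (u , v)) f
  respects-snoc {es = es} old new xy∈ with ∈-++⁻ es xy∈
  ... | inj₁ xy∈es          = old xy∈es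
  ... | inj₂ (here refl) = new

  join-tracks : ∀ {es e rep loc Z} (inv : Invariant rep loc Z) {a b} (a≢b : a ≢ b) (rep-a : rep a ≡ a) (rep-b : rep b ≡ b)
    (a≤b : size rep a ≤ size rep b) (d : Dec (∃ (Valid (relabel a b ∘ rep)))) →
    Components es rep → Respects (es ∷ʳ e) (relabel a b ∘ rep) → (∀ (σ : Config ℓ n) → Respects (es ∷ʳ e) σ → σ a ≡ σ b) →
    (∃ λ (σ : Config ℓ n) → Respects (es ∷ʳ e) σ × CapOK k σ) →
    let st = join-state inv a≢b rep-a rep-b a≤b d in
    Tracks (es ∷ʳ e) (Z + moves (loc ∘ rep) (conf st)) st
  join-tracks {es} {e} {rep} {loc} {Z} inv {a} {b} a≢b rep-a rep-b a≤b d comps sound′ joined (σ₀ , resp₀ , cap₀) = decide d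
    where
    open Components comps
    through : ∀ (σ : Config ℓ n) → Respects (es ∷ʳ e) σ → ∀ x → σ x ≡ σ (relabel a b (rep x))
    through σ resp x = trans (complete σ (respects-init resp) (sym (Invariant.idempotent inv x))) (go (rep x ≟ a))
      where
      go : Dec (rep x ≡ a) → σ (rep x) ≡ σ (relabel a b (rep x))
      go (yes e)   = trans (cong σ e) (trans (joined σ resp) (cong σ (sym (trans (cong (relabel a b) e) (relabel-hit a b)))))
      go (no ne) = cong σ (sym (relabel-miss ne))
    decide : (d : Dec (∃ (Valid (relabel a b ∘ rep)))) → let st = join-state inv a≢b rep-a rep-b a≤b d in Tracks (es ∷ʳ e) (Z + moves (loc ∘ rep) (conf st)) st
    decide (yes (τ , valid)) = record
      { sound    = sound′
      ; complete = λ σ resp {x} {y} eq → trans (through σ resp x) (trans (cong σ eq) (sym (through σ resp y)))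
      } , refl
    -- The feasible vertex assignment factors through the new labels, hence is itself a valid
    -- assignment of components.
    decide (no ¬valid) = ¬valid (σ₀ , λ s → ≤-trans (≤-reflexive (load-cong (λ v → sym (through σ₀ resp₀ v)) s)) (cap₀ s))

  advance-tracks : ∀ es e Z₀ st → Tracks es Z₀ st → (∃ λ (σ : Config ℓ n) → Respects (es ∷ʳ e) σ × CapOK k σ) →
    Tracks (es ∷ʳ e) (Z₀ + moves (conf st) (conf (advance st e))) (advance st e)
  advance-tracks es (u , v) Z₀ (alive rep loc Z inv) (comps , refl) feasible with rep u ≟ rep v
  ... | yes same = record
    { sound    = respects-snoc (Components.sound comps) same
    ; complete = λ σ resp → Components.complete comps σ (respects-init resp)
    } , sym (trans (cong (Z +_) (moves-refl (loc ∘ rep))) (+-identityʳ Z))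
  ... | no ne with ≤-total (size rep (rep u)) (size rep (rep v))
  ...   | inj₁ u≤v = join-tracks {es} inv ne (Invariant.idempotent inv u) (Invariant.idempotent inv v) u≤v (valid? (relabel (rep u) (rep v) ∘ rep)) comps
          (respects-snoc (λ xy∈ → cong (relabel (rep u) (rep v)) (Components.sound comps xy∈)) (trans (relabel-hit (rep u) (rep v)) (sym (relabel-miss (ne ∘ sym)))))
          (λ σ resp → trans (sym (rep-respected σ resp u)) (trans (respects-last es resp) (rep-respected σ resp v))) feasible
    where
    rep-respected : ∀ (σ : Config ℓ n) → Respects (es ∷ʳ (u , v)) σ → ∀ x → σ x ≡ σ (rep x)
    rep-respected σ resp x = Components.complete comps σ (respects-init resp) (sym (Invariant.idempotent inv x))
  ...   | inj₂ v≤u = join-tracks {es} inv (ne ∘ sym) (Invariant.idempotent inv v) (Invariant.idempotent inv u) v≤u (valid? (relabel (rep v) (rep u) ∘ rep)) comps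
          (respects-snoc (λ xy∈ → cong (relabel (rep v) (rep u)) (Components.sound comps xy∈)) (trans (relabel-miss ne) (sym (relabel-hit (rep v) (rep u)))))
          (λ σ resp → trans (sym (rep-respected σ resp v)) (trans (sym (respects-last es resp)) (rep-respected σ resp u))) feasible
    where
    rep-respected : ∀ (σ : Config ℓ n) → Respects (es ∷ʳ (u , v)) σ → ∀ x → σ x ≡ σ (rep x)
    rep-respected σ resp x = Components.complete comps σ (respects-init resp) (sym (Invariant.idempotent inv x))

-- Competitive analysis

-- For `ℓ = 0` there are no vertices, so nothing moves.
moves≤ℓ*moves : ∀ ℓ k (σ τ : Config ℓ (ℓ * k)) → moves σ τ ≤ ℓ * moves σ τ
moves≤ℓ*moves zero    k σ τ = z≤n
moves≤ℓ*moves (suc ℓ) k σ τ = m≤n*m (moves σ τ) (suc ℓ)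

-- By the triangle inequality, the final configuration alone yields a lower bound on the offline
-- cost.
moves≤sumTo : ∀ {ℓ n} (S : ℕ → Config ℓ n) t → moves (S 0) (S t) ≤ sumTo t (λ i → moves (S i) (S (suc i)))
moves≤sumTo S zero    = ≤-reflexive (moves-refl (S 0))
moves≤sumTo S (suc t) = ≤-trans (moves-triangle (S 0) (S t) (S (suc t))) (+-monoˡ-≤ _ (moves≤sumTo S t))

CC⇒edge : ∀ {ℓ n es} {σ : Config ℓ n} → CC es σ → ∀ {x y} → (x , y) ∈ es → σ x ≡ σ y
CC⇒edge cc {x} {y} xy∈ = cc x y (fwd xy∈ here)

edge⇒CC : ∀ {ℓ n es} {σ : Config ℓ n} → (∀ {x y} → (x , y) ∈ es → σ x ≡ σ y) → CC es σ
edge⇒CC resp u .u here        = refl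
edge⇒CC resp u w (fwd uv∈ c) = trans (resp uv∈) (edge⇒CC resp _ w c)
edge⇒CC resp u w (bwd vu∈ c) = trans (sym (resp vu∈)) (edge⇒CC resp _ w c)

module Analysis (ℓ k m : ℕ) .{{_ : NonZero k}} (m>0 : 0 < m) (k≥2 : 2 ≤ k) (init : Config ℓ (ℓ * k)) (balanced : Balanced k init) where

  open Algorithm ℓ k m m>0 init balanced

  private
    n = ℓ * k

  -- Allows constant terms to be absorbed into the logarithm.
  R≥1 : 1 ≤ R
  R≥1 = ⌊log₂⌋-mono-≤ k≥2

  sum-size : ∀ rep → sum (size rep) ≡ n
  sum-size rep = trans (sum-cl-total rep (λ _ → 1)) (sum-1 n)

  -- Ranks are at most `R`, sizes add up to `n`, and the packing bounds the total weight by `ℓ * G`.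
  sum-Θ≤ : ∀ rep loc → (∀ c → size rep c ≤ k) → Packs rep loc → sum (Θ rep) ≤ R * n + B * k * (2 * (ℓ * G))
  sum-Θ≤ rep loc fits packs = begin
    sum (Θ rep)
      ≤⟨ sum-mono (λ c → +-mono-≤ (≤-trans (*-monoʳ-≤ (size rep c) (rank≤R rep fits c)) (≤-reflexive (*-comm (size rep c) R)))
           (*-monoʳ-≤ (B * k) (≤-trans (eventPotential≤ (w c)) (≤-reflexive (sym (cong (w c +_) (+-identityʳ (w c)))))))) ⟩
    sum (λ c → R * size rep c + B * k * (2 * w c))
      ≡⟨ ∑-distrib-+ (λ c → R * size rep c) (λ c → B * k * (2 * w c)) ⟩
    sum (λ c → R * size rep c) + sum (λ c → B * k * (2 * w c))
      ≡⟨ cong₂ _+_ (*-distribˡ-sum R (size rep)) (trans (cong (B * k *_) (*-distribˡ-sum 2 w)) (*-distribˡ-sum (B * k) (λ c → 2 * w c))) ⟨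
    R * sum (size rep) + B * k * (2 * sum w)
      ≤⟨ +-mono-≤ (≤-reflexive (cong (R *_) (sum-size rep))) (*-monoʳ-≤ (B * k) (*-monoʳ-≤ 2 total-weight)) ⟩
    R * n + B * k * (2 * (ℓ * G)) ∎
    where
    open ≤-Reasoning
    w : Fin n → ℕ
    w c = weight (size rep c)
    total-weight : sum w ≤ ℓ * G
    total-weight = ≤-trans (≤-reflexive (sym (sum-cl-total loc w))) (≤-trans (sum-mono packs) (≤-reflexive (sum-const ℓ G)))

  -- The majority phase has cost `O(D log k)` directly. In the packing phase the cost is
  -- `O(ℓ k log k)`, and `far` replaces `k` by a multiple of `D`.
  competitive : ∀ {rep loc Z} → Invariant rep loc Z → ∀ τ → Z ≤ ratio m * ℓ * R * D rep τ
  competitive {rep} {loc} {Z} inv τ with Invariant.phase inv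
  ... | inj₁ phase₁ = begin
    Z                                     ≤⟨ Phase₁.paid phase₁ τ ⟩
    sum (Ψ rep loc τ)                     ≤⟨ sum-Ψ≤ {rep} {loc} R (rank≤R rep (Invariant.fits inv)) τ ⟩
    16 * (R * d) + 4 * D rep loc          ≤⟨ +-monoʳ-≤ (16 * (R * d)) (*-monoʳ-≤ 4 (D-majority {rep} {loc} (Phase₁.majority phase₁) τ)) ⟩
    16 * (R * d) + 4 * (4 * d)            ≤⟨ +-monoʳ-≤ (16 * (R * d)) (≤-trans (≤-reflexive (sym (*-assoc 4 4 d))) (*-monoʳ-≤ 16 (m≤n*m d R {{>-nonZero R≥1}}))) ⟩
    16 * (R * d) + 16 * (R * d)           ≡⟨ arith₁ R d ⟩
    32 * R * d                            ≤⟨ *-monoʳ-≤ (32 * R) (moves≤ℓ*moves ℓ k init (τ ∘ rep)) ⟩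
    32 * R * (ℓ * d)                      ≡⟨ arith₂ R ℓ d ⟩
    32 * ℓ * R * d                        ≤⟨ *-monoˡ-≤ d (*-monoˡ-≤ R (*-monoˡ-≤ ℓ (m≤m+n 32 (4 * m * (22 + 2 * B * G))))) ⟩
    ratio m * ℓ * R * d                   ∎
    where
    open ≤-Reasoning
    d = D rep τ
    arith₁ : ∀ R d → 16 * (R * d) + 16 * (R * d) ≡ 32 * R * d
    arith₁ = solve-∀
    arith₂ : ∀ R ℓ d → 32 * R * (ℓ * d) ≡ 32 * ℓ * R * d
    arith₂ = solve-∀
  ... | inj₂ phase₂ = *-cancelˡ-≤ m {{>-nonZero m>0}} (begin
    m * Z                                                      ≤⟨ m≤m+n (m * Z) (Φ (loc ∘ rep)) ⟩
    m * Z + Φ (loc ∘ rep)                                      ≤⟨ Phase₂.paid phase₂ ⟩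
    2 * m * (K₀ + sum (Θ rep))                                 ≤⟨ *-monoʳ-≤ (2 * m) (+-monoʳ-≤ K₀ (sum-Θ≤ rep loc (Invariant.fits inv) (Phase₂.packs phase₂))) ⟩
    2 * m * ((16 * R + 5) * (ℓ * k) + (R * (ℓ * k) + B * k * (2 * (ℓ * G))))
      ≡⟨ arith₁ m R ℓ k B G ⟩
    m * (2 * ℓ * k * (17 * R + (5 + 2 * B * G)))
      ≤⟨ *-monoʳ-≤ m (*-monoʳ-≤ (2 * ℓ * k) (+-monoʳ-≤ (17 * R) (m≤m*n (5 + 2 * B * G) R {{>-nonZero R≥1}}))) ⟩
    m * (2 * ℓ * k * (17 * R + (5 + 2 * B * G) * R))
      ≡⟨ arith₂ m ℓ k R (2 * B * G) ⟩
    m * (2 * ℓ * R * (22 + 2 * B * G) * k)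
      ≤⟨ *-monoʳ-≤ m (*-monoʳ-≤ (2 * ℓ * R * (22 + 2 * B * G)) (Phase₂.far phase₂ τ)) ⟩
    m * (2 * ℓ * R * (22 + 2 * B * G) * (2 * m * d))
      ≡⟨ cong (m *_) (arith₃ ℓ R (22 + 2 * B * G) m d) ⟩
    m * (4 * m * (22 + 2 * B * G) * ℓ * R * d)
      ≤⟨ *-monoʳ-≤ m (*-monoˡ-≤ d (*-monoˡ-≤ R (*-monoˡ-≤ ℓ (m≤n+m (4 * m * (22 + 2 * B * G)) 32)))) ⟩
    m * (ratio m * ℓ * R * d)                                  ∎)
    where
    open ≤-Reasoning
    d = D rep τ
    arith₁ : ∀ m R ℓ k B G → 2 * m * ((16 * R + 5) * (ℓ * k) + (R * (ℓ * k) + B * k * (2 * (ℓ * G)))) ≡ m * (2 * ℓ * k * (17 * R + (5 + 2 * B * G)))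
    arith₁ = solve-∀
    arith₂ : ∀ m ℓ k R x → m * (2 * ℓ * k * (17 * R + (5 + x) * R)) ≡ m * (2 * ℓ * R * (22 + x) * k)
    arith₂ = solve-∀
    arith₃ : ∀ ℓ R x m d → 2 * ℓ * R * x * (2 * m * d) ≡ 4 * m * x * ℓ * R * d
    arith₃ = solve-∀

  module _ (A : OnlineAlg ℓ k) (agrees : ∀ es → A init es ≡ output es) (es : List (Edge n)) (valid : ValidSeq ℓ k es) where

    private
      onlConf-run : ∀ t → onlConf A init es t ≡ conf (run (take t es))
      onlConf-run zero    = refl
      onlConf-run (suc t) = agrees (take (suc t) es)

      cost : ℕ → ℕ
      cost t = sumTo t (λ i → moves (onlConf A init es i) (onlConf A init es (suc i)))

    tracks : ∀ t → t ≤ length es → Tracks (take t es) (cost t) (run (take t es))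
    tracks zero    _   = record { sound = λ () ; complete = λ { σ _ refl → refl } } , refl
    tracks (suc t) t<  = subst₂ (λ x y → Tracks (take (suc t) es) (cost t + x) y) (sym step-cost) (sym step-run)
      (subst (λ es′ → Tracks es′ (cost t + moves (conf st) (conf (advance st e))) (advance st e)) (sym snoc)
        (advance-tracks (take t es) e (cost t) st (tracks t (<⇒≤ t<)) feasible))
      where
      e  = lookup es (fromℕ< t<)
      st = run (take t es)
      snoc : take (suc t) es ≡ take t es ∷ʳ e
      snoc = subst (λ i → take (suc i) es ≡ take i es ∷ʳ e) (toℕ-fromℕ< t<) (take-suc es (fromℕ< t<))
      step-run : run (take (suc t) es) ≡ advance st e
      step-run = trans (cong run snoc) (foldl-∷ʳ advance start e (take t es))
      step-cost : moves (onlConf A init es t) (onlConf A init es (suc t)) ≡ moves (conf st) (conf (advance st e))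
      step-cost = cong₂ moves (onlConf-run t) (trans (onlConf-run (suc t)) (cong conf step-run))
      feasible : ∃ λ (σ : Config ℓ n) → Respects (take t es ∷ʳ e) σ × CapOK k σ
      feasible with valid (suc t) t<
      ... | σ , cc , cap = σ , CC⇒edge (subst (λ es′ → CC es′ σ) snoc cc) , cap

    feasible : ∀ t → t ≤ length es →
      CC (take t es) (onlConf A init es t) × (∀ s → m * load (onlConf A init es t) s ≤ suc (suc m) * k)
    feasible t t≤ = subst (λ σ → CC (take t es) σ × (∀ s → m * load σ s ≤ suc (suc m) * k)) (sym (onlConf-run t))
      (check (run (take t es)) (tracks t t≤))
      where
      check : ∀ st → Tracks (take t es) (cost t) st → CC (take t es) (conf st) × (∀ s → m * load (conf st) s ≤ suc (suc m) * k)
      check (alive rep loc Z inv) (comps , _) = edge⇒CC (λ xy∈ → cong loc (Components.sound comps xy∈)) , Invariant.cap inv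

    bounded : (S : ℕ → Config ℓ n) → OffFeasible init es S → onlMoves A init es ≤ ratio m * ℓ * R * offMoves es S
    bounded S (S₀ , feasible) = check (run (take T es)) (tracks T ≤-refl)
      where
      T = length es
      check : ∀ st → Tracks (take T es) (cost T) st → cost T ≤ ratio m * ℓ * R * offMoves es S
      -- Labels are vertices, so the final offline configuration `S T` is also an assignment of
      -- labels; completeness identifies it with `S T ∘ rep`.
      check (alive rep loc Z inv) (comps , refl) = ≤-trans (competitive inv (S T)) (*-monoʳ-≤ (ratio m * ℓ * R) (begin
        moves init (S T ∘ rep)   ≡⟨ moves-cong (λ v → sym (S₀ v)) (λ v → Components.complete comps (S T) (CC⇒edge (proj₁ (feasible T ≤-refl))) (Invariant.idempotent inv v)) ⟩
        moves (S 0) (S T)        ≤⟨ moves≤sumTo S T ⟩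
        offMoves es S            ∎))
        where open ≤-Reasoning

-- Rational side conditions

open import Data.Integer using (+_; +[1+_]; +0; -[1+_])
open import Data.Rational using (ℚ; mkℚ; _/_; 0ℚ; 1ℚ; *<*; *≤*)

-- For `ε` with denominator `q` and `m = 2 q`, the guaranteed capacity is
-- `(1 + 2/m) k = (1 + 1/q) k`, and `ε ≥ 1/q` because its numerator is positive.
augmented-cap : ∀ ε → 0ℚ ℚ.< ε → ∀ k l → 2 * ℚ.↧ₙ ε * l ≤ (2 + 2 * ℚ.↧ₙ ε) * k →
  (+ l / 1) ℚ.≤ (1ℚ ℚ.+ ε) ℚ.* (+ k / 1)
augmented-cap (mkℚ +0 d _) (*<* (ℤ.+<+ ())) k l cap
augmented-cap (mkℚ -[1+ _ ] d _) (*<* ()) k l cap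
augmented-cap ε@(mkℚ +[1+ e ] d _) _ k l cap = ℚ.toℚᵘ-cancel-≤ (begin
  ℚ.toℚᵘ (+ l / 1)                                   ≃⟨ ℚ.toℚᵘ-fromℚᵘ (ℚᵘ.mkℚᵘ (+ l) 0) ⟩
  ℚᵘ.mkℚᵘ (+ l) 0                                    ≤⟨ ℚᵘ.*≤* numerators ⟩
  (ℚᵘ.1ℚᵘ ℚᵘ.+ ℚ.toℚᵘ ε) ℚᵘ.* ℚᵘ.mkℚᵘ (+ k) 0         ≃⟨ ℚᵘ.*-cong (ℚ.toℚᵘ-homo-+ 1ℚ ε) (ℚ.toℚᵘ-fromℚᵘ (ℚᵘ.mkℚᵘ (+ k) 0)) ⟨
  ℚ.toℚᵘ (1ℚ ℚ.+ ε) ℚᵘ.* ℚ.toℚᵘ (+ k / 1)            ≃⟨ ℚ.toℚᵘ-homo-* (1ℚ ℚ.+ ε) (+ k / 1) ⟨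
  ℚ.toℚᵘ ((1ℚ ℚ.+ ε) ℚ.* (+ k / 1))                  ∎)
  where
  open ℚᵘ.≤-Reasoning
  arith₁ : ∀ l d → 2 * (l * suc d) ≡ 2 * suc d * l
  arith₁ = solve-∀
  arith₂ : ∀ k d → (2 + 2 * suc d) * k ≡ 2 * ((suc d + 1) * k)
  arith₂ = solve-∀
  natural : l * suc d ≤ (suc d + suc e) * k
  natural = *-cancelˡ-≤ 2 (≤-trans (≤-reflexive (arith₁ l d)) (≤-trans cap
    (≤-trans (≤-reflexive (arith₂ k d)) (*-monoʳ-≤ 2 (*-monoˡ-≤ k (+-monoʳ-≤ (suc d) (s≤s z≤n)))))))
  lhs≡ : + l ℤ.* ℚᵘ.↧ ((ℚᵘ.1ℚᵘ ℚᵘ.+ ℚ.toℚᵘ ε) ℚᵘ.* ℚᵘ.mkℚᵘ (+ k) 0) ≡ + (l * suc d)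
  lhs≡ = trans (sym (ℤ.pos-* l _)) (cong (λ x → + (l * suc x)) (trans (*-identityʳ _) (+-identityʳ d)))
  rhs≡ : ℚᵘ.↥ ((ℚᵘ.1ℚᵘ ℚᵘ.+ ℚ.toℚᵘ ε) ℚᵘ.* ℚᵘ.mkℚᵘ (+ k) 0) ℤ.* + 1 ≡ + ((suc d + suc e) * k)
  rhs≡ = trans (ℤ.*-identityʳ _) (trans (cong₂ (λ x y → (+ x ℤ.+ + y) ℤ.* + k) (+-identityʳ (suc d)) (*-identityʳ (suc e))) (sym (ℤ.pos-* (suc d + suc e) k)))
  numerators : + l ℤ.* ℚᵘ.↧ ((ℚᵘ.1ℚᵘ ℚᵘ.+ ℚ.toℚᵘ ε) ℚᵘ.* ℚᵘ.mkℚᵘ (+ k) 0) ℤ.≤ ℚᵘ.↥ ((ℚᵘ.1ℚᵘ ℚᵘ.+ ℚ.toℚᵘ ε) ℚᵘ.* ℚᵘ.mkℚᵘ (+ k) 0) ℤ.* + 1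
  numerators = subst₂ ℤ._≤_ (sym lhs≡) (sym rhs≡) (ℤ.+≤+ natural)

ε⁴≤1 : ∀ ε → 0ℚ ℚ.< ε → ε ℚ.< + 1 / 4 → ε ℚ.* ε ℚ.* ε ℚ.* ε ℚ.≤ 1ℚ
ε⁴≤1 ε ε>0 ε<¼ = shrink (shrink (shrink ε≤1))
  where
  instance
    nonneg : ℚ.NonNegative ε
    nonneg = ℚ.nonNegative (ℚ.<⇒≤ ε>0)
  ε≤1 : ε ℚ.≤ 1ℚ
  ε≤1 = ℚ.≤-trans (ℚ.<⇒≤ ε<¼) (*≤* (ℤ.+≤+ (s≤s z≤n)))
  shrink : ∀ {x} → x ℚ.≤ 1ℚ → x ℚ.* ε ℚ.≤ 1ℚ
  shrink {x} x≤1 = ℚ.≤-trans (ℚ.*-monoʳ-≤-nonNeg ε x≤1) (ℚ.≤-trans (ℚ.≤-reflexive (ℚ.*-identityˡ ε)) ε≤1)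

-- For `k = 1` the lower bound on `ε` would give `10 ≤ ε⁴ ≤ 1`. This secures a positive logarithm.
capacity≥2 : ∀ ε → 0ℚ ℚ.< ε → ε ℚ.< + 1 / 4 → ∀ k .{{_ : NonZero k}} → + 10 / k ℚ.≤ ε ℚ.* ε ℚ.* ε ℚ.* ε → 2 ≤ k
capacity≥2 ε ε>0 ε<¼ zero          h = contradiction refl (≢-nonZero⁻¹ zero)
capacity≥2 ε ε>0 ε<¼ (suc zero)    h with ℚ.≤-trans h (ε⁴≤1 ε ε>0 ε<¼)
... | *≤* (ℤ.+≤+ (s≤s ()))
capacity≥2 ε ε>0 ε<¼ (suc (suc k)) h = s≤s (s≤s z≤n)

-- Assembly of the algorithm and the competitive bound

module _ (ℓ k m : ℕ) .{{_ : NonZero k}} (m>0 : 0 < m) where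

  -- The construction starts from a proof of balance, whereas an online algorithm accepts any
  -- initial configuration; an unbalanced one is returned unchanged.
  algorithm-if : ∀ init → Dec (Balanced k init) → List (Edge (ℓ * k)) → Config ℓ (ℓ * k)
  algorithm-if init (yes balanced) es = Algorithm.output ℓ k m m>0 init balanced es
  algorithm-if init (no _)         es = init

  balanced? : ∀ init → Dec (Balanced k init)
  balanced? init = all? (λ s → load {ℓ} {ℓ * k} init s ≟ℕ k)

  algorithm : OnlineAlg ℓ k
  algorithm init = algorithm-if init (balanced? init)

  -- The balance proof is existential because the one found by the decision need not be the given
  -- one.
  algorithm-agrees : ∀ init → Balanced k init → ∃ λ balanced → ∀ es →
    algorithm init es ≡ Algorithm.output ℓ k m m>0 init balanced es
  algorithm-agrees init balanced = go (balanced? init)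
    where
    go : ∀ d → ∃ λ balanced → ∀ es →
      algorithm-if init d es ≡ Algorithm.output ℓ k m m>0 init balanced es
    go (yes balanced) = balanced , λ _ → refl
    go (no ¬balanced) = contradiction balanced ¬balanced

theorem5p1 : (ε : ℚ) → 0ℚ Data.Rational.< ε → ε Data.Rational.< + 1 / 4 →
    ∃ λ (C : ℕ) → (ℓ k : ℕ) → .{{_ : NonZero k}} →
    + 10 / k Data.Rational.≤ ε Data.Rational.* ε Data.Rational.* ε Data.Rational.* ε →
    ∃ λ (A : OnlineAlg ℓ k) →
    (init : Config ℓ (ℓ * k)) → Balanced k init →
    (es : List (Edge (ℓ * k))) → ValidSeq ℓ k es →
    OnlFeasible ε A init es ×
    ((S : ℕ → Config ℓ (ℓ * k)) → OffFeasible init es S →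
    onlMoves A init es ≤ C * ℓ * ⌊log₂ k ⌋ * offMoves es S)
theorem5p1 ε ε>0 ε<¼ = ratio m , λ ℓ k large → algorithm ℓ k m m>0 , prove ℓ k large
  where
  -- Twice the denominator of `ε`, so that `2/m ≤ ε`; the constant `ratio m` then depends on `ε`
  -- alone.
  m : ℕ
  m = 2 * ℚ.↧ₙ ε
  m>0 : 0 < m
  m>0 = s≤s z≤n
  prove : (ℓ k : ℕ) → .{{_ : NonZero k}} →
    + 10 / k ℚ.≤ ε ℚ.* ε ℚ.* ε ℚ.* ε →
    (init : Config ℓ (ℓ * k)) → Balanced k init →
    (es : List (Edge (ℓ * k))) → ValidSeq ℓ k es →
    OnlFeasible ε (algorithm ℓ k m m>0) init es ×
    ((S : ℕ → Config ℓ (ℓ * k)) → OffFeasible init es S →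
    onlMoves (algorithm ℓ k m m>0) init es ≤ ratio m * ℓ * ⌊log₂ k ⌋ * offMoves es S)
  prove ℓ k large init bal es valid = finish (algorithm-agrees ℓ k m m>0 init bal)
    where
    k≥2 : 2 ≤ k
    k≥2 = capacity≥2 ε ε>0 ε<¼ k large
    finish : (∃ λ balanced → ∀ es → algorithm ℓ k m m>0 init es ≡ Algorithm.output ℓ k m m>0 init balanced es) →
      OnlFeasible ε (algorithm ℓ k m m>0) init es ×
      ((S : ℕ → Config ℓ (ℓ * k)) → OffFeasible init es S →
      onlMoves (algorithm ℓ k m m>0) init es ≤ ratio m * ℓ * ⌊log₂ k ⌋ * offMoves es S)
    finish (balanced , agrees) =
      (λ t t≤ → let (cc , cap) = feasible (algorithm ℓ k m m>0) agrees es valid t t≤ in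
        cc , λ s → augmented-cap ε ε>0 k (load (onlConf (algorithm ℓ k m m>0) init es t) s) (cap s)) ,
      bounded (algorithm ℓ k m m>0) agrees es valid
      where open Analysis ℓ k m m>0 k≥2 init balanced
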